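{- Let $1<x<y$ and $a,b,c\ge0$ be integers, let $v=a+b+c+1$, and suppose $L=\{1^a,x^b,y^c\}$ is strongly admissible. Let $\dot x=\min(\widehat{x^{ -1}y},\widehat{x^{ -1}})$, $\dot y=\max(\widehat{x^{ -1}y},\widehat{x^{ -1}})$, $\ddot x=\min(\widehat{y^{ -1}},\widehat{xy^{ -1}})$, $\ddot y=\max(\widehat{y^{ -1}},\widehat{xy^{ -1}})$, where inverses are taken modulo $v$. Define, for integers $1<p<s$, $$f(p,s)=\begin{cases} s-1 & \text{if } p \text{ and } s \text{ are even},\\ p+s-2 & \text{if } p=3, \text{ or } p \text{ is even and } s \text{ is odd},\\ p+s-1 & \text{otherwise.}\end{cases}$$ If $a\ge f(x,y)$, or $b\ge f(\dot x,\dot y)$, or $c\ge f(\ddot x,\ddot y)$, then $L$ is realizable. In particular, if $L$ is not realizable then $f(x,y)+f(\dot x,\dot y)+f(\ddot x,\ddot y)\ge v+2$.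
   Context: $K_v$ is the complete graph on vertex set $\{0,\dots,v-1\}$; the length of an edge $\{u,w\}$ is $\min(|u-w|,v-|u-w|)$. A multiset $L$ of size $v-1$ is realizable if some Hamiltonian path in $K_v$ has multiset of edge lengths equal to $L$. $\{x_1^{a_1},\dots\}$ denotes the multiset with $x_i$ of multiplicity $a_i$; $\mathrm{supp}(L)$ is its set of distinct elements. $L$ of size $v-1$ is strongly admissible if $\mathrm{supp}(L)\subseteq\{1,\dots,\lfloor v/2\rfloor\}$ and $\gcd(v,z)=1$ for all $z\in L$. For a nonzero residue $g$ modulo $v$ with representative $g'\in\{1,\dots,v-1\}$, $\widehat g=\min(g',v-g')$. -}

module Defs where

open import Data.Nat using (ℕ; zero; suc; _+_; _*_; _∸_; _≤_; _⊓_; _⊔_; _%_; _/_; ∣_-_∣; _≡ᵇ_)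
open import Data.Nat.GCD using (gcd)
open import Data.Bool using (Bool; true; false; if_then_else_; _∧_; _∨_; not)
open import Data.List using (List; []; _∷_; _++_; replicate; upTo)
open import Data.List.Relation.Unary.All using (All)
open import Data.List.Relation.Binary.Permutation.Propositional using (_↭_)
open import Data.Product using (∃; _×_)
open import Relation.Binary.PropositionalEquality using (_≡_)

edgeLen : ℕ → ℕ → ℕ → ℕ
edgeLen v u w = ∣ u - w ∣ ⊓ (v ∸ ∣ u - w ∣)

edgeLengths : ℕ → List ℕ → List ℕ
edgeLengths v [] = []
edgeLengths v (u ∷ []) = []
edgeLengths v (u ∷ w ∷ p) = edgeLen v u w ∷ edgeLengths v (w ∷ p)

HamPath : ℕ → List ℕ → Set
HamPath v p = p ↭ upTo v

Realizable : ℕ → List ℕ → Set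
Realizable v L = ∃ λ p → HamPath v p × (edgeLengths v p ↭ L)

StronglyAdmissible : ℕ → List ℕ → Set
StronglyAdmissible v L =
  (Data.List.length L ≡ v ∸ 1) × All (λ z → (1 ≤ z) × (z ≤ v / 2) × (gcd v z ≡ 1)) L
  where import Data.List

-- hat of a residue g mod v: min(g', v - g') with g' = g mod v
-- residue of g modulo v (v = 0 does not occur in the statement)
res : ℕ → ℕ → ℕ
res zero g = g
res (suc n) g = g % suc n

hat : ℕ → ℕ → ℕ
hat v g = res v g ⊓ (v ∸ res v g)

even : ℕ → Bool
even n = (n % 2) ≡ᵇ 0

f : ℕ → ℕ → ℕ
f p s =
  if even p ∧ even s then s ∸ 1
  else if (p ≡ᵇ 3) ∨ (even p ∧ not (even s)) then p + s ∸ 2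
  else p + s ∸ 1

L3 : ℕ → ℕ → ℕ → ℕ → ℕ → List ℕ
L3 a b c x y = replicate a 1 ++ replicate b x ++ replicate c y

{-# OPTIONS --safe #-}
module Submission where

-- Multiplying the vertices by the unit x (or y) modulo v permutes the lengths, so all three cases
-- reduce to one: if 1 ≤ p ≤ s and a ≥ f p s, then {1^a, p^b, s^c} is the multiset of the differences
-- of a Hamiltonian path on {0, …, n - 1}, taken as integers.  Such paths are grown from small ones:
-- if t and t + 1 are consecutive in a path on {0, …, t + d - 1}, inserting t + d and t + d + 1 between
-- them adds two edges of length d and keeps the number of edges of length 1.  For even d the top d
-- vertices can be kept paired up for ever.  For odd d one of them stays unpaired and has to be an
-- endpoint of the path; when the count of edges has the wrong parity, one more edge of length 1 is
-- spent on rerouting the path at that endpoint.  The two lengths p and s are combined by gluing a path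
-- for p to a path for s, by linking them with an edge of length p, or by growing both in one path.
open import Defs
import Algebra.Solver.CommutativeMonoid
open import Algebra.Bundles using (CommutativeMonoid)
open import Data.Bool using (true; false)
open import Data.Bool.Properties using (∨-zeroʳ)
open import Data.Empty using (⊥; ⊥-elim)
open import Data.List using (List; []; _∷_; _++_; replicate; reverse; map; length; upTo; applyUpTo)
open import Data.List.Membership.Propositional using (_∈_)
open import Data.List.Membership.Propositional.Properties using (∈-upTo⁺; ∈-upTo⁻; ∈-map⁺; ∈-map⁻)
open import Data.List.Membership.Propositional.Properties.WithK using (unique∧set⇒bag)
open import Data.List.Properties
  using (++-assoc; unfold-reverse; reverse-++; length-++; length-replicate; map-++; map-replicate; map-upTo)
open import Data.List.Relation.Binary.BagAndSetEquality using (∼bag⇒↭)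
open import Data.List.Relation.Binary.Permutation.Propositional hiding (trans)
open import Data.List.Relation.Binary.Permutation.Propositional.Properties
  using (++⁺; ++⁺ˡ; ++⁺ʳ; ++-comm; shift; drop-∷; ↭-length; ↭-reverse; map⁺; All-resp-↭; ++-isCommutativeMonoid)
open import Data.List.Relation.Unary.All as All using (All; []; _∷_)
open import Data.List.Relation.Unary.All.Properties using (++⁻ˡ; ++⁻ʳ)
open import Data.List.Relation.Unary.Unique.Propositional using (Unique)
open import Data.List.Relation.Unary.Unique.Propositional.Properties using (applyUpTo⁺₁; upTo⁺)
open import Data.Nat
open import Data.Nat.DivMod
open import Data.Nat.GCD using (gcd)
open import Data.Nat.Properties
open import Data.Nat.Tactic.RingSolver using (solve-∀)
open import Data.Product using (∃; _×_; _,_; proj₁; proj₂)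
open import Data.Sum using (_⊎_; inj₁; inj₂)
open import Data.Unit using (⊤; tt)
open import Function using (_∘_; id)
open import Function.Bundles using (mk⇔)
open import Level using (0ℓ)
open import Relation.Binary.PropositionalEquality
open import Relation.Nullary using (¬_; yes; no)

-- The constants of `f` are prices in edges of length 1. A block of `d` consecutive vertices on
-- which growth by `d` can start costs `d - 1` of them, and for even `d` nothing more. For odd `d` a
-- round of growth adds `d` edges of length `d`: every pair grows once and the path is prolonged
-- once at the unpaired endpoint. Stopping inside a round gives the multiplicities with an even
-- residue modulo `d`; an odd residue, once the multiplicity exceeds `d`, costs one more edge (`bad`
-- in `Count`). The length 3 escapes: its only odd residue, 1, is reached from 0, 3, 2, 1. Gluing
-- adds prices: at most `p + s - 2`, `p + s - 1` or `p + s` for zero, one or two odd lengths other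
-- than 3. For two even lengths the shorter block fits inside the longer one, which leaves `s - 1`.
-- For an even and a larger odd length, for 3 and a larger odd one, and for two odd lengths, gluing
-- is one edge too dear when the multiplicities are bad. Saving that single edge is what the crest,
-- the linking edge and the paths with a prescribed first vertex are for.

gaps : List ℕ → List ℕ
gaps [] = []
gaps (u ∷ []) = []
gaps (u ∷ w ∷ p) = ∣ u - w ∣ ∷ gaps (w ∷ p)

asc : ℕ → ℕ → List ℕ
asc m zero = []
asc m (suc k) = m ∷ asc (suc m) k

desc : ℕ → ℕ → List ℕ
desc m k = reverse (asc m k)

data Head (h : ℕ) : List ℕ → Set where
  head : ∀ {p} → Head h (h ∷ p)

data Last (s : ℕ) : List ℕ → Set where
  last  : Last s (s ∷ [])
  later : ∀ {u p} → Last s p → Last s (u ∷ p)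

-- The direction of traversal is kept because `turn` depends on it; for growth alone the undirected
-- `Adj` is enough.
data Cons (u w : ℕ) : List ℕ → Set where
  here  : ∀ {p} → Cons u w (u ∷ w ∷ p)
  there : ∀ {v p} → Cons u w p → Cons u w (v ∷ p)

Adj : ℕ → List ℕ → Set
Adj t p = Cons t (suc t) p ⊎ Cons (suc t) t p

-- The pairs are disjoint and nothing is asked about edges between them, so growing one pair leaves
-- the others intact.
Pairs : List ℕ → ℕ → ℕ → Set
Pairs p m zero = ⊤
Pairs p m (suc k) = Adj m p × Pairs p (2 + m) k

asc-++ : ∀ m k l → asc m (k + l) ≡ asc m k ++ asc (k + m) l
asc-++ m zero l = refl
asc-++ m (suc k) l = cong (m ∷_) (trans (asc-++ (suc m) k l) (cong (λ z → asc (suc m) k ++ asc z l) (+-suc k m)))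

asc-snoc : ∀ m k → asc m (suc k) ≡ asc m k ++ (k + m) ∷ []
asc-snoc m k = trans (cong (asc m) (+-comm 1 k)) (asc-++ m k 1)

map-+-asc : ∀ d m k → map (d +_) (asc m k) ≡ asc (d + m) k
map-+-asc d m zero = refl
map-+-asc d m (suc k) = cong (d + m ∷_) (trans (map-+-asc d (suc m) k) (cong (λ z → asc z k) (+-suc d m)))

asc-upTo : ∀ n → asc 0 n ≡ upTo n
asc-upTo n = go 0 n id (λ i → sym (+-identityʳ i))
  where
  go : ∀ m n (f : ℕ → ℕ) → (∀ i → f i ≡ i + m) → asc m n ≡ applyUpTo f n
  go m zero f e = refl
  go m (suc n) f e = cong₂ _∷_ (sym (e 0)) (go (suc m) n (f ∘ suc) (λ i → trans (e (suc i)) (sym (+-suc i m))))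

length-asc : ∀ m k → length (asc m k) ≡ k
length-asc m zero = refl
length-asc m (suc k) = cong suc (length-asc (suc m) k)

desc-suc : ∀ m k → desc m (suc k) ≡ (k + m) ∷ desc m k
desc-suc m k = trans (cong reverse (asc-snoc m k)) (reverse-++ (asc m k) ((k + m) ∷ []))

reflect-asc : ∀ j k → map (j + k ∸_) (asc (suc j) k) ≡ desc 0 k
reflect-asc j zero = refl
reflect-asc j (suc k) = begin
  map (j + suc k ∸_) (asc (suc j) (suc k))
    ≡⟨ cong (λ z → map (z ∸_) (asc (suc j) (suc k))) (+-suc j k) ⟩
  (j + k ∸ j) ∷ map (suc j + k ∸_) (asc (2 + j) k)
    ≡⟨ cong₂ _∷_ (trans (m+n∸m≡n j k) (sym (+-identityʳ k))) (reflect-asc (suc j) k) ⟩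
  k + 0 ∷ desc 0 k
    ≡⟨ sym (desc-suc 0 k) ⟩
  desc 0 (suc k) ∎
  where open ≡-Reasoning

reflect-asc₀ : ∀ k → map (k ∸_) (asc 0 (suc k)) ≡ desc 0 (suc k)
reflect-asc₀ k = trans (cong₂ _∷_ (sym (+-identityʳ k)) (reflect-asc 0 k)) (sym (desc-suc 0 k))

Cons-++ʳ : ∀ {u w p} q → Cons u w p → Cons u w (p ++ q)
Cons-++ʳ q here = here
Cons-++ʳ q (there c) = there (Cons-++ʳ q c)

Cons-++ˡ : ∀ {u w p} q → Cons u w p → Cons u w (q ++ p)
Cons-++ˡ [] c = c
Cons-++ˡ (v ∷ q) c = there (Cons-++ˡ q c)

Adj-map : ∀ {t p q} → (∀ {u w} → Cons u w p → Cons u w q) → Adj t p → Adj t q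
Adj-map f (inj₁ c) = inj₁ (f c)
Adj-map f (inj₂ c) = inj₂ (f c)

Cons-snoc₂ : ∀ u w p → Cons u w (p ++ u ∷ w ∷ [])
Cons-snoc₂ u w p = Cons-++ˡ p here

Cons-reverse : ∀ {u w p} → Cons u w p → Cons w u (reverse p)
Cons-reverse {u} {w} (here {p}) =
  subst (Cons w u) (sym (trans (unfold-reverse u (w ∷ p)) (trans (cong (_++ u ∷ []) (unfold-reverse w p)) (++-assoc (reverse p) _ _))))
    (Cons-snoc₂ w u (reverse p))
Cons-reverse (there {v} {p} c) = subst (Cons _ _) (sym (unfold-reverse v p)) (Cons-++ʳ (v ∷ []) (Cons-reverse c))

Adj-reverse : ∀ {t p} → Adj t p → Adj t (reverse p)
Adj-reverse (inj₁ c) = inj₂ (Cons-reverse c)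
Adj-reverse (inj₂ c) = inj₁ (Cons-reverse c)

Cons-map : ∀ (f : ℕ → ℕ) {u w p} → Cons u w p → Cons (f u) (f w) (map f p)
Cons-map f here = here
Cons-map f (there c) = there (Cons-map f c)

Cons-asc : ∀ m k t → m ≤ t → 2 + t ≤ k + m → Cons t (suc t) (asc m k)
Cons-asc m zero t m≤t t< = ⊥-elim (<-irrefl refl (≤-trans (s≤s m≤t) (≤-trans (n≤1+n _) t<)))
Cons-asc m (suc k) t m≤t t< with m≤n⇒m<n∨m≡n m≤t
... | inj₁ m<t = there (Cons-asc (suc m) k t m<t (subst (2 + t ≤_) (sym (+-suc k m)) t<))
Cons-asc m (suc zero) t m≤t t< | inj₂ refl = ⊥-elim (<-irrefl refl t<)
Cons-asc m (suc (suc k)) t m≤t t< | inj₂ refl = here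

Head-++ : ∀ {h p} q → Head h p → Head h (p ++ q)
Head-++ q head = head

Last-++ʳ : ∀ {s q} p → Last s q → Last s (p ++ q)
Last-++ʳ [] l = l
Last-++ʳ (u ∷ p) l = later (Last-++ʳ p l)

Last-asc : ∀ m k → Last (k + m) (asc m (suc k))
Last-asc m k = subst (Last (k + m)) (sym (asc-snoc m k)) (Last-++ʳ (asc m k) last)

Head-desc : ∀ m k → Head (k + m) (desc m (suc k))
Head-desc m k = subst (Head (k + m)) (sym (desc-suc m k)) head

Last-reverse : ∀ {h p} → Head h p → Last h (reverse p)
Last-reverse {h} (head {p}) = subst (Last h) (sym (unfold-reverse h p)) (Last-++ʳ (reverse p) last)

Head-reverse : ∀ {s p} → Last s p → Head s (reverse p)
Head-reverse last = head
Head-reverse {s} (later {u} {p} l) = subst (Head s) (sym (unfold-reverse u p)) (Head-++ (u ∷ []) (Head-reverse l))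

Head-map : ∀ (f : ℕ → ℕ) {s p} → Head s p → Head (f s) (map f p)
Head-map f head = head

gaps-++ : ∀ {a b p q} → Last a p → Head b q → gaps (p ++ q) ≡ gaps p ++ ∣ a - b ∣ ∷ gaps q
gaps-++ last head = refl
gaps-++ (later {u} last) head = refl
gaps-++ (later {u} (later {w} l)) hd = cong (∣ u - w ∣ ∷_) (gaps-++ (later l) hd)

gaps-split : ∀ p u q → gaps (p ++ u ∷ q) ≡ gaps (p ++ u ∷ []) ++ gaps (u ∷ q)
gaps-split [] u q = refl
gaps-split (v ∷ []) u q = refl
gaps-split (v ∷ w ∷ p) u q = cong (∣ v - w ∣ ∷_) (gaps-split (w ∷ p) u q)

gaps-reverse : ∀ p → gaps (reverse p) ↭ gaps p
gaps-reverse [] = ↭-refl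
gaps-reverse (u ∷ []) = ↭-refl
gaps-reverse (u ∷ w ∷ p) = begin
  gaps (reverse (u ∷ w ∷ p))
    ≡⟨ cong gaps (unfold-reverse u (w ∷ p)) ⟩
  gaps (reverse (w ∷ p) ++ u ∷ [])
    ≡⟨ gaps-++ (Last-reverse {w} {w ∷ p} head) head ⟩
  gaps (reverse (w ∷ p)) ++ ∣ w - u ∣ ∷ []
    ↭⟨ ++-comm (gaps (reverse (w ∷ p))) _ ⟩
  ∣ w - u ∣ ∷ gaps (reverse (w ∷ p))
    ↭⟨ ↭-prep _ (gaps-reverse (w ∷ p)) ⟩
  ∣ w - u ∣ ∷ gaps (w ∷ p)
    ≡⟨ cong (_∷ gaps (w ∷ p)) (∣-∣-comm w u) ⟩
  ∣ u - w ∣ ∷ gaps (w ∷ p) ∎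
  where open PermutationReasoning

gaps-shift : ∀ m p → gaps (map (m +_) p) ≡ gaps p
gaps-shift m [] = refl
gaps-shift m (u ∷ []) = refl
gaps-shift m (u ∷ w ∷ p) = cong₂ _∷_ (∣m+n-m+o∣≡∣n-o∣ m u w) (gaps-shift m (w ∷ p))

∣n-sucn∣≡1 : ∀ n → ∣ n - suc n ∣ ≡ 1
∣n-sucn∣≡1 zero = refl
∣n-sucn∣≡1 (suc n) = ∣n-sucn∣≡1 n

gaps-asc : ∀ m k → gaps (asc m (suc k)) ≡ replicate k 1
gaps-asc m zero = refl
gaps-asc m (suc k) = cong₂ _∷_ (∣n-sucn∣≡1 m) (gaps-asc (suc m) k)

gaps-desc : ∀ m k → gaps (desc m (suc k)) ↭ replicate k 1
gaps-desc m k = ↭-trans (gaps-reverse (asc m (suc k))) (↭-reflexive (gaps-asc m k))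

All-asc : ∀ m k → All (_< k + m) (asc m k)
All-asc m zero = []
All-asc m (suc k) = s≤s (m≤n+m m k) ∷ subst (λ z → All (_< z) (asc (suc m) k)) (+-suc k m) (All-asc (suc m) k)

∣-∣-reflect : ∀ m {u w} → u ≤ m → w ≤ m → ∣ (m ∸ u) - (m ∸ w) ∣ ≡ ∣ u - w ∣
∣-∣-reflect m {u} {w} u≤m w≤m = begin
  ∣ (m ∸ u) - (m ∸ w) ∣
    ≡⟨ sym (∣m+n-m+o∣≡∣n-o∣ (u + w) (m ∸ u) (m ∸ w)) ⟩
  ∣ u + w + (m ∸ u) - u + w + (m ∸ w) ∣
    ≡⟨ cong₂ ∣_-_∣ (trans (cong (_+ (m ∸ u)) (+-comm u w)) (lem w u u≤m)) (lem u w w≤m) ⟩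
  ∣ w + m - u + m ∣
    ≡⟨ cong₂ ∣_-_∣ (+-comm w m) (+-comm u m) ⟩
  ∣ m + w - m + u ∣
    ≡⟨ trans (∣m+n-m+o∣≡∣n-o∣ m w u) (∣-∣-comm w u) ⟩
  ∣ u - w ∣ ∎
  where
  open ≡-Reasoning
  lem : ∀ a b → b ≤ m → a + b + (m ∸ b) ≡ a + m
  lem a b b≤m = trans (+-assoc a b _) (cong (a +_) (m+[n∸m]≡n b≤m))

gaps-reflect : ∀ m {p} → All (_≤ m) p → gaps (map (m ∸_) p) ≡ gaps p
gaps-reflect m [] = refl
gaps-reflect m (a ∷ []) = refl
gaps-reflect m (a ∷ b ∷ as) = cong₂ _∷_ (∣-∣-reflect m a b) (gaps-reflect m (b ∷ as))

-- Surgery on a path: insertion and rotation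

ins : ∀ {u w p} → Cons u w p → List ℕ → List ℕ
ins {u} {w} (here {p}) qs = u ∷ qs ++ w ∷ p
ins (there {v} c) qs = v ∷ ins c qs

ins-↭ : ∀ {u w p} (c : Cons u w p) qs → ins c qs ↭ qs ++ p
ins-↭ {u} {w} (here {p}) qs = ↭-sym (shift u qs (w ∷ p))
ins-↭ (there {v} {p} c) qs = ↭-trans (↭-prep v (ins-↭ c qs)) (↭-sym (shift v qs p))

ins-Head : ∀ {h u w p} (c : Cons u w p) qs → Head h p → Head h (ins c qs)
ins-Head here qs head = head
ins-Head (there c) qs head = head

ins-Last : ∀ {s u w p} (c : Cons u w p) qs → Last s p → Last s (ins c qs)
ins-Last {u = u} here qs (later l) = Last-++ʳ (u ∷ qs) l
ins-Last (there c) qs (later l) = later (ins-Last c qs l)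

Cons-Head : ∀ {u h p} → Head h p → Cons u h (u ∷ p)
Cons-Head head = here

gaps-∷ : ∀ {u h p} → Head h p → gaps (u ∷ p) ≡ ∣ u - h ∣ ∷ gaps p
gaps-∷ head = refl

Cons⇒Head : ∀ {u w p} → Cons u w p → ∃ λ h → Head h p
Cons⇒Head here = _ , head
Cons⇒Head (there c) = _ , head

ins-Cons : ∀ {u w u′ w′ p} (c : Cons u w p) qs → (u′ ≡ u → w′ ≡ w → ⊥) → Cons u′ w′ p → Cons u′ w′ (ins c qs)
ins-Cons here qs ne here = ⊥-elim (ne refl refl)
ins-Cons {u = u} here qs ne (there c′) = Cons-++ˡ (u ∷ qs) c′
ins-Cons (there c) qs ne here = Cons-Head (ins-Head c qs head)
ins-Cons (there c) qs ne (there c′) = there (ins-Cons c qs ne c′)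

-- E collects the edge lengths gained when the edge u – w is replaced by a path through qs.
ins-gaps : ∀ {u w p} (c : Cons u w p) qs {E} → gaps (u ∷ qs ++ w ∷ []) ↭ ∣ u - w ∣ ∷ E →
  gaps (ins c qs) ↭ E ++ gaps p
ins-gaps {u} {w} (here {p}) qs {E} e = begin
  gaps (u ∷ qs ++ w ∷ p)                   ≡⟨ gaps-split (u ∷ qs) w p ⟩
  gaps (u ∷ qs ++ w ∷ []) ++ gaps (w ∷ p)  ↭⟨ ++⁺ʳ (gaps (w ∷ p)) e ⟩
  ∣ u - w ∣ ∷ E ++ gaps (w ∷ p)            ↭⟨ ↭-sym (shift _ E _) ⟩
  E ++ gaps (u ∷ w ∷ p) ∎
  where open PermutationReasoning
ins-gaps (there {v} {p} c) qs {E} e with Cons⇒Head c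
... | h , hd = begin
  gaps (v ∷ ins c qs)            ≡⟨ gaps-∷ (ins-Head c qs hd) ⟩
  ∣ v - h ∣ ∷ gaps (ins c qs)    ↭⟨ ↭-prep _ (ins-gaps c qs e) ⟩
  ∣ v - h ∣ ∷ E ++ gaps p        ↭⟨ ↭-sym (shift _ E _) ⟩
  E ++ ∣ v - h ∣ ∷ gaps p        ≡⟨ cong (E ++_) (sym (gaps-∷ hd)) ⟩
  E ++ gaps (v ∷ p) ∎
  where open PermutationReasoning

-- A Pósa rotation with `qs` spliced in: the old last vertex is attached to the end of `qs`, and `w`
-- becomes the new endpoint.
rot : ∀ {u w p} → Cons u w p → List ℕ → List ℕ
rot {u} {w} (here {p}) qs = u ∷ qs ++ reverse (w ∷ p)
rot (there {v} c) qs = v ∷ rot c qs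

rot-Head : ∀ {h u w p} (c : Cons u w p) qs → Head h p → Head h (rot c qs)
rot-Head here qs head = head
rot-Head (there c) qs head = head

rot-↭ : ∀ {u w p} (c : Cons u w p) qs → rot c qs ↭ qs ++ p
rot-↭ {u} {w} (here {p}) qs =
  ↭-trans (↭-prep u (++⁺ˡ qs (↭-reverse (w ∷ p)))) (↭-sym (shift u qs (w ∷ p)))
rot-↭ (there {v} {p} c) qs = ↭-trans (↭-prep v (rot-↭ c qs)) (↭-sym (shift v qs p))

rot-new : ∀ {u w p a b} (c : Cons u w p) qs → Cons a b (u ∷ qs) → Cons a b (rot c qs)
rot-new {w = w} (here {p}) qs = Cons-++ʳ (reverse (w ∷ p))
rot-new (there c) qs c′ = there (rot-new c qs c′)

rot-Cons : ∀ {u w u′ w′ p} (c : Cons u w p) qs → (u′ ≡ u → w′ ≡ w → ⊥) → Cons u′ w′ p →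
  Cons u′ w′ (rot c qs) ⊎ Cons w′ u′ (rot c qs)
rot-Cons here qs ne here = ⊥-elim (ne refl refl)
rot-Cons {u = u} here qs ne (there c′) = inj₂ (Cons-++ˡ (u ∷ qs) (Cons-reverse c′))
rot-Cons (there c) qs ne here = inj₁ (Cons-Head (rot-Head c qs head))
rot-Cons (there c) qs ne (there c′) with rot-Cons c qs ne c′
... | inj₁ r = inj₁ (there r)
... | inj₂ r = inj₂ (there r)

rot-gaps : ∀ {s u w p} (c : Cons u w p) qs {E} → Last s p → gaps (u ∷ qs ++ s ∷ []) ↭ ∣ u - w ∣ ∷ E →
  gaps (rot c qs) ↭ E ++ gaps p
rot-gaps {s} {u} {w} (here {p}) qs {E} (later l) e with reverse (w ∷ p) in eq | Head-reverse l
... | .s ∷ r | head = begin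
  gaps (u ∷ qs ++ s ∷ r)                   ≡⟨ gaps-split (u ∷ qs) s r ⟩
  gaps (u ∷ qs ++ s ∷ []) ++ gaps (s ∷ r)  ↭⟨ ++⁺ e (↭-trans (↭-reflexive (cong gaps (sym eq))) (gaps-reverse (w ∷ p))) ⟩
  ∣ u - w ∣ ∷ E ++ gaps (w ∷ p)            ↭⟨ ↭-sym (shift _ E _) ⟩
  E ++ gaps (u ∷ w ∷ p) ∎
  where open PermutationReasoning
rot-gaps (there {v} {p} c) qs {E} (later l) e with Cons⇒Head c
... | h , hd = begin
  gaps (v ∷ rot c qs)            ≡⟨ gaps-∷ (rot-Head c qs hd) ⟩
  ∣ v - h ∣ ∷ gaps (rot c qs)    ↭⟨ ↭-prep _ (rot-gaps c qs l e) ⟩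
  ∣ v - h ∣ ∷ E ++ gaps p        ↭⟨ ↭-sym (shift _ E _) ⟩
  E ++ ∣ v - h ∣ ∷ gaps p        ≡⟨ cong (E ++_) (sym (gaps-∷ hd)) ⟩
  E ++ gaps (v ∷ p) ∎
  where open PermutationReasoning

-- Growth

record Path (n : ℕ) (L p : List ℕ) : Set where
  constructor path
  field
    cover : p ↭ asc 0 n
    steps : gaps p ↭ L

open Path public

castPath : ∀ {n n′ L p} → n ≡ n′ → Path n L p → Path n′ L p
castPath refl π = π

asc-extend : ∀ n k → asc n k ++ asc 0 n ↭ asc 0 (k + n)
asc-extend n k = begin
  asc n k ++ asc 0 n         ↭⟨ ++-comm (asc n k) _ ⟩
  asc 0 n ++ asc n k         ≡⟨ cong (λ z → asc 0 n ++ asc z k) (sym (+-identityʳ n)) ⟩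
  asc 0 n ++ asc (n + 0) k   ≡⟨ sym (asc-++ 0 n k) ⟩
  asc 0 (n + k)              ≡⟨ cong (asc 0) (+-comm n k) ⟩
  asc 0 (k + n) ∎
  where open PermutationReasoning

extend : ∀ {n L p p′ k E} → Path n L p → p′ ↭ asc n k ++ p → gaps p′ ↭ E ++ gaps p → Path (k + n) (E ++ L) p′
extend {n} {k = k} {E} π c g = path
  (↭-trans c (↭-trans (++⁺ˡ (asc n k) (cover π)) (asc-extend n k)))
  (↭-trans g (++⁺ˡ E (steps π)))

+-suc₂ : ∀ a b → a + (2 + b) ≡ 2 + (a + b)
+-suc₂ a b = trans (+-suc a (suc b)) (cong suc (+-suc a b))

Pairs-map : ∀ {p p′ m} k → (∀ t → m ≤ t → Adj t p → Adj t p′) → Pairs p m k → Pairs p′ m k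
Pairs-map zero f ps = tt
Pairs-map (suc k) f (a , ps) = f _ ≤-refl a , Pairs-map k (λ t le → f t (≤-trans (m≤n+m _ 2) le)) ps

Pairs-++ : ∀ {p m} k l → Pairs p m k → Pairs p (k * 2 + m) l → Pairs p m (k + l)
Pairs-++ zero l _ qs = qs
Pairs-++ {p} {m} (suc k) l (a , ps) qs =
  a , Pairs-++ k l ps (subst (λ z → Pairs p z l) (sym (+-suc₂ _ _)) qs)

Pairs-snoc : ∀ {p m} k → Pairs p m k → Adj (k * 2 + m) p → Pairs p m (suc k)
Pairs-snoc {p} {m} k ps a = subst (Pairs p m) (+-comm k 1) (Pairs-++ k 1 ps (a , tt))

Pairs-drop : ∀ {p m} k l → Pairs p m (k + l) → Pairs p (k * 2 + m) l
Pairs-drop zero l ps = ps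
Pairs-drop {p} {m} (suc k) l (_ , ps) =
  subst (λ z → Pairs p z l) (+-suc₂ _ _) (Pairs-drop k l ps)

Pairs-intro : ∀ {p m} k → (∀ t → m ≤ t → 2 + t ≤ k * 2 + m → Adj t p) → Pairs p m k
Pairs-intro zero f = tt
Pairs-intro {p} {m} (suc k) f =
  f m ≤-refl (s≤s (s≤s (m≤n+m m (k * 2)))) ,
  Pairs-intro k (λ t le le′ → f t (≤-trans (m≤n+m m 2) le)
    (subst (2 + t ≤_) (+-suc₂ _ _) le′))

record Grown (d t : ℕ) (p p′ : List ℕ) : Set where
  field
    perm    : p′ ↭ d + t ∷ suc (d + t) ∷ p
    gain    : gaps p′ ↭ d ∷ d ∷ gaps p
    keep    : ∀ {t′} → t′ ≢ t → Adj t′ p → Adj t′ p′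
    keepUp  : ∀ {t′} → t′ ≢ t → Cons t′ (suc t′) p → Cons t′ (suc t′) p′
    keepHead : ∀ {h} → Head h p → Head h p′
    keepLast : ∀ {s} → Last s p → Last s p′

open Grown public

∣-∣-+ʳ : ∀ d u → ∣ u - d + u ∣ ≡ d
∣-∣-+ʳ d u = trans (cong (∣ u -_∣) (+-comm d u)) (∣m-m+n∣≡n u d)

∣-∣-+ˡ : ∀ d u → ∣ d + u - u ∣ ≡ d
∣-∣-+ˡ d u = trans (∣-∣-comm (d + u) u) (∣-∣-+ʳ d u)

-- The edge from `u` to `w` is translated by `d` and tied to its old ends: its length survives and
-- two edges of length `d` are gained.
parallel-gaps : ∀ d u w → gaps (u ∷ d + u ∷ d + w ∷ w ∷ []) ↭ ∣ u - w ∣ ∷ d ∷ d ∷ []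
parallel-gaps d u w = ↭-trans
  (↭-reflexive (cong₂ _∷_ (∣-∣-+ʳ d u) (cong₂ (λ a b → a ∷ b ∷ []) (∣m+n-m+o∣≡∣n-o∣ d u w) (∣-∣-+ˡ d w))))
  (↭-swap _ _ ↭-refl)

insAlong : ∀ d {u w p} → Cons u w p → List ℕ
insAlong d {u} {w} c = ins c (d + u ∷ d + w ∷ [])

insAlong-new : ∀ d {u w p} (c : Cons u w p) → Cons (d + u) (d + w) (insAlong d c)
insAlong-new d here = there here
insAlong-new d (there c) = there (insAlong-new d c)

2+n≢n : ∀ {n} → 2 + n ≢ n
2+n≢n {n} e = m≢1+n+m n {1} (sym e)

growUp : ∀ d {t p} → Cons t (suc t) p →
  ∃ λ p′ → Grown d t p p′ × Cons (d + t) (suc (d + t)) p′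
growUp d {t} {p} c = insAlong d c , record
  { perm = subst (λ z → insAlong d c ↭ d + t ∷ z ∷ p) (+-suc d t) (ins-↭ c _)
  ; gain = ins-gaps c _ (parallel-gaps d t (suc t))
  ; keep = λ { ne (inj₁ a) → inj₁ (ins-Cons c _ (λ e _ → ne e) a)
             ; ne (inj₂ a) → inj₂ (ins-Cons c _ (λ e e′ → 2+n≢n (trans (cong suc (sym e′)) e)) a) }
  ; keepUp = λ ne → ins-Cons c _ (λ e _ → ne e)
  ; keepHead = ins-Head c _
  ; keepLast = ins-Last c _ }
  , subst (λ z → Cons (d + t) z (insAlong d c)) (+-suc d t) (insAlong-new d c)

growDown : ∀ d {t p} → Cons (suc t) t p →
  ∃ λ p′ → Grown d t p p′ × Cons (suc (d + t)) (d + t) p′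
growDown d {t} {p} c = insAlong d c , record
  { perm = ↭-trans (subst (λ z → insAlong d c ↭ z ∷ d + t ∷ p) (+-suc d t) (ins-↭ c _)) (↭-swap _ _ ↭-refl)
  ; gain = ↭-trans (ins-gaps c _ (parallel-gaps d (suc t) t)) ↭-refl
  ; keep = λ { ne (inj₁ a) → inj₁ (ins-Cons c _ (λ e e′ → 2+n≢n (trans (cong suc (sym e)) e′)) a)
             ; ne (inj₂ a) → inj₂ (ins-Cons c _ (λ _ e → ne e) a) }
  ; keepUp = λ ne → ins-Cons c _ (λ e e′ → 2+n≢n (trans (cong suc (sym e)) e′))
  ; keepHead = ins-Head c _
  ; keepLast = ins-Last c _ }
  , subst (λ z → Cons z (d + t) (insAlong d c)) (+-suc d t) (insAlong-new d c)

grow : ∀ d {t p} → Adj t p → ∃ λ p′ → Grown d t p p′ × Adj (d + t) p′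
grow d (inj₁ c) with growUp d c
... | p′ , g , n = p′ , g , inj₁ n
grow d (inj₂ c) with growDown d c
... | p′ , g , n = p′ , g , inj₂ n

Grown-Path : ∀ {d t n L p p′} → n ≡ d + t → Path n L p → Grown d t p p′ → Path (2 + n) (d ∷ d ∷ L) p′
Grown-Path refl π g = extend {k = 2} {E = _ ∷ _ ∷ []} π (perm g) (gain g)

-- c is the number of edges of length 2 g; n₀ and L₀ do not change during growth.
record Even (g h n₀ : ℕ) (L₀ : List ℕ) (c : ℕ) : Set where
  field
    p     : List ℕ
    m     : ℕ
    isPath : Path (c + n₀) (replicate c (g * 2) ++ L₀) p
    hd    : Head h p
    size  : c + n₀ ≡ g * 2 + m
    block : Pairs p m g

-- The lowest pair of the block is spent and its translate on top replaces it, so the block moves up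
-- by two and has the same shape as before.
evenStep : ∀ {g h n₀ L₀ c} → Even (suc g) h n₀ L₀ c → Even (suc g) h n₀ L₀ (2 + c)
evenStep {g} record { m = m ; isPath = π ; hd = hd ; size = size ; block = (a , ps) }
  with grow (suc g * 2) a
... | p′ , G , a′ = record
  { m = 2 + m
  ; isPath = Grown-Path size π G
  ; hd = keepHead G hd
  ; size = trans (cong (2 +_) size) (sym (+-suc₂ (suc g * 2) m))
  ; block = Pairs-snoc g (Pairs-map g (λ t le → keep G λ { refl → 1+n≰n (≤-trans (n≤1+n _) le) }) ps)
      (subst (λ z → Adj z p′) (sym (+-suc₂ (g * 2) m)) a′) }

evenGrow : ∀ {g h n₀ L₀ c} k → Even (suc g) h n₀ L₀ c → Even (suc g) h n₀ L₀ (k * 2 + c)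
evenGrow zero E = E
evenGrow (suc k) E = evenStep (evenGrow k E)

-- This is the value of `2 + V`. With no pair below `S` the cyclic predecessor is the top pair,
-- ending just below the number `n` of vertices; otherwise it ends just below `S`.
precedes : ℕ → ℕ → ℕ → ℕ
precedes zero S n = n
precedes (suc _) S n = S

-- From the bottom, the top y vertices are i pairs, the last vertex S of the path, and j pairs.  The
-- pair V, V + 1 that precedes S cyclically in this block must be traversed upwards for turn to apply.
record Odd (y h n₀ : ℕ) (L₀ : List ℕ) (i j c : ℕ) : Set where
  field
    p       : List ℕ
    m S V   : ℕ
    isPath  : Path (c + n₀) (replicate c y ++ L₀) p
    hd      : Head h p
    lst     : Last S p
    size    : c + n₀ ≡ y + m
    sizeS   : S ≡ i * 2 + m
    sizeJ   : c + n₀ ≡ j * 2 + suc S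
    below   : Pairs p m i
    above   : Pairs p (suc S) j
    prev    : Cons V (suc V) p
    sizeV   : 2 + V ≡ precedes i S (c + n₀)

pairStep : ∀ {y h n₀ L₀ i j c} → Odd y h n₀ L₀ (suc i) j c → Odd y h n₀ L₀ i (suc j) (2 + c)
-- Here the only pair below `S` is `V`, `V + 1` itself. It is grown with its direction known, and
-- its translate becomes the new `prev`, now on top.
pairStep {y} {i = zero} {j} record { p = p ; m = m ; isPath = π ; hd = hd ; lst = lst ; size = size
  ; sizeS = refl ; sizeJ = sizeJ ; below = _ , _ ; above = above ; prev = prev ; sizeV = refl }
  with growUp y prev
... | p′ , G , new = record
  { m = 2 + m
  ; V = y + m
  ; isPath = Grown-Path size π G
  ; hd = keepHead G hd
  ; lst = keepLast G lst
  ; size = trans (cong (2 +_) size) (sym (+-suc₂ y m))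
  ; sizeS = refl
  ; sizeJ = cong (2 +_) sizeJ
  ; below = tt
  ; above = Pairs-snoc j
      (Pairs-map j (λ t le → keep G λ { refl → 1+n≰n (≤-trans (≤-trans (n≤1+n _) (n≤1+n _)) le) }) above)
      (subst (λ z → Adj z p′) (trans (sym size) sizeJ) (inj₁ new))
  ; prev = new
  ; sizeV = cong (2 +_) (sym size) }
pairStep {y} {i = suc i} {j} record { p = p ; m = m ; S = S ; V = V ; isPath = π ; hd = hd ; lst = lst ; size = size
  ; sizeS = sizeS ; sizeJ = sizeJ ; below = a , below ; above = above ; prev = prev ; sizeV = sizeV }
  with grow y a
... | p′ , G , new = record
  { m = 2 + m
  ; V = V
  ; isPath = Grown-Path size π G
  ; hd = keepHead G hd
  ; lst = keepLast G lst
  ; size = trans (cong (2 +_) size) (sym (+-suc₂ y m))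
  ; sizeS = trans sizeS (sym (+-suc₂ (suc i * 2) m))
  ; sizeJ = cong (2 +_) sizeJ
  ; below = Pairs-map (suc i) (λ t le → keep G λ { refl → 1+n≰n (≤-trans (n≤1+n _) le) }) below
  ; above = Pairs-snoc j
      (Pairs-map j (λ t le → keep G λ { refl → 1+n≰n (≤-trans le m≤S) }) above)
      (subst (λ z → Adj z p′) (trans (sym size) sizeJ) new)
  ; prev = keepUp G (λ { refl → m≢1+n+m m {1 + i * 2} (suc-injective (suc-injective (trans sizeV sizeS))) }) prev
  ; sizeV = sizeV }
  where
  m≤S : m ≤ S
  m≤S = subst (m ≤_) (sym sizeS) (m≤n+m m _)

Adj-++ʳ : ∀ {t p} q → Adj t p → Adj t (p ++ q)
Adj-++ʳ q = Adj-map (Cons-++ʳ q)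

Adj-++ˡ : ∀ {t p} q → Adj t p → Adj t (q ++ p)
Adj-++ˡ q = Adj-map (Cons-++ˡ q)

snoc-gaps : ∀ {s p} w → Last s p → gaps (p ++ w ∷ []) ↭ ∣ s - w ∣ ∷ gaps p
snoc-gaps {s} {p} w l = ↭-trans (↭-reflexive (gaps-++ l head)) (++-comm (gaps p) _)

-- The unpaired vertex is now the lowest of the block. Being the endpoint, it can be joined to
-- `y + m`, which becomes the unpaired top vertex with all pairs below it.
singleStep : ∀ {y h n₀ L₀ j c} → Odd y h n₀ L₀ 0 (suc j) c → Odd y h n₀ L₀ (suc j) 0 (suc c)
singleStep {y} {j = j} {c} record { p = p ; m = m ; V = V ; isPath = π ; hd = hd ; lst = lst ; size = size
  ; sizeS = refl ; sizeJ = sizeJ ; above = above ; prev = prev ; sizeV = sizeV } = record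
  { m = suc m
  ; V = V
  ; isPath = extend {k = 1} {E = y ∷ []} π (++-comm p _)
      (↭-trans (snoc-gaps _ lst) (↭-reflexive (cong (_∷ gaps p) (trans (cong (∣ m -_∣) size) (∣-∣-+ʳ y m)))))
  ; hd = Head-++ _ hd
  ; lst = Last-++ʳ p last
  ; size = trans (cong suc size) (sym (+-suc y m))
  ; sizeS = sizeJ
  ; sizeJ = refl
  ; below = Pairs-map (suc j) (λ t _ → Adj-++ʳ _) above
  ; above = tt
  ; prev = Cons-++ʳ _ prev
  ; sizeV = sizeV }

pairSteps : ∀ {y h n₀ L₀ i j c} k → Odd y h n₀ L₀ (k + i) j c → Odd y h n₀ L₀ i (k + j) (k * 2 + c)
pairSteps zero O = O
pairSteps {y} {h} {n₀} {L₀} {i} {j} {c} (suc k) O =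
  pairStep (pairSteps k (subst (λ z → Odd y h n₀ L₀ z j c) (sym (+-suc k i)) O))

-- `i` pair steps bring `S` to the bottom of the block, a single step lifts it to the top, and `j`
-- pair steps restore its position: `2 i + 1 + 2 j = y` edges.
round : ∀ {h n₀ L₀ c} i j l → i + j ≡ suc l → let y = suc (suc l * 2) in
  Odd y h n₀ L₀ i j c → Odd y h n₀ L₀ i j (y + c)
round {h} {n₀} {L₀} {c} i j l eq O =
  subst₂ (Odd y h n₀ L₀ i) (+-identityʳ j) eqc (pairSteps j O₃)
  where
  y : ℕ
  y = suc (suc l * 2)
  O₁ : Odd y h n₀ L₀ 0 (suc l) (i * 2 + c)
  O₁ = subst (λ z → Odd y h n₀ L₀ 0 z (i * 2 + c)) eq
         (pairSteps i (subst (λ z → Odd y h n₀ L₀ z j c) (sym (+-identityʳ i)) O))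
  O₃ : Odd y h n₀ L₀ (j + i) 0 (suc (i * 2 + c))
  O₃ = subst (λ z → Odd y h n₀ L₀ z 0 (suc (i * 2 + c))) (trans (sym eq) (+-comm i j)) (singleStep O₁)
  eqc : j * 2 + suc (i * 2 + c) ≡ y + c
  eqc = begin
    j * 2 + suc (i * 2 + c)   ≡⟨ +-suc (j * 2) _ ⟩
    suc (j * 2 + (i * 2 + c)) ≡⟨ cong suc (sym (+-assoc (j * 2) (i * 2) c)) ⟩
    suc (j * 2 + i * 2 + c)   ≡⟨ cong (λ z → suc (z + c)) (sym (*-distribʳ-+ 2 j i)) ⟩
    suc ((j + i) * 2 + c)     ≡⟨ cong (λ z → suc (z * 2 + c)) (trans (+-comm j i) eq) ⟩
    y + c ∎
    where open ≡-Reasoning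

rounds : ∀ {h n₀ L₀ c} i j l q → i + j ≡ suc l → let y = suc (suc l * 2) in
  Odd y h n₀ L₀ i j c → Odd y h n₀ L₀ i j (q * y + c)
rounds i j l zero eq O = O
rounds {h} {n₀} {L₀} {c} i j l (suc q) eq O =
  subst (Odd _ h n₀ L₀ i j) (sym (+-assoc (suc (suc l * 2)) (q * suc (suc l * 2)) c))
    (round i j l eq (rounds i j l q eq O))

-- r pairs at the bottom of the block of the top y vertices may still be grown; l pairs at the top
-- are the result of growth.
record Fan (y h n₀ : ℕ) (L₀ : List ℕ) (r l c : ℕ) : Set where
  field
    p      : List ℕ
    m N    : ℕ
    isPath : Path (c + n₀) (replicate c y ++ L₀) p
    hd     : Head h p
    size   : c + n₀ ≡ y + m
    sizeN  : c + n₀ ≡ l * 2 + N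
    bound  : r * 2 + m ≤ N
    block  : Pairs p m r
    top    : Pairs p N l

fanStep : ∀ {y h n₀ L₀ r l c} → Fan y h n₀ L₀ (suc r) l c → Fan y h n₀ L₀ r (suc l) (2 + c)
fanStep {y} {r = r} {l} record { m = m ; N = N ; isPath = π ; hd = hd ; size = size ; sizeN = sizeN
  ; bound = bound ; block = a , ps ; top = top } with grow y a
... | p′ , G , new = record
  { m = 2 + m
  ; N = N
  ; isPath = Grown-Path size π G
  ; hd = keepHead G hd
  ; size = trans (cong (2 +_) size) (sym (+-suc₂ y m))
  ; sizeN = cong (2 +_) sizeN
  ; bound = subst (_≤ N) (sym (+-suc₂ (r * 2) m)) bound
  ; block = Pairs-map r (λ t le → keep G λ { refl → 1+n≰n (≤-trans (n≤1+n _) le) }) ps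
  ; top = Pairs-snoc l
      (Pairs-map l (λ t le → keep G λ { refl → 1+n≰n (≤-trans (≤-trans (s≤s (m≤n+m m (suc (r * 2)))) bound) le) }) top)
      (subst (λ z → Adj z p′) (trans (sym size) sizeN) new) }

fanSteps : ∀ {y h n₀ L₀ r l c} k → Fan y h n₀ L₀ (k + r) l c → Fan y h n₀ L₀ r (k + l) (k * 2 + c)
fanSteps zero F = F
fanSteps {y} {h} {n₀} {L₀} {r} {l} {c} (suc k) F =
  fanStep (fanSteps k (subst (λ z → Fan y h n₀ L₀ z l c) (sym (+-suc k r)) F))

-- Trades the endpoint for one more edge of length 1, which changes the parity of the number of
-- edges of length y that can be reached.
turn : ∀ {y h n₀ L₀ j c} → Odd y h n₀ L₀ 1 j c → Fan y h (suc n₀) (1 ∷ L₀) (suc j) 0 (2 + c)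
turn {y} {h} {n₀} {L₀} {j} {c} record { p = p ; m = m ; isPath = π ; hd = hd ; lst = lst ; size = size
  ; sizeS = refl ; sizeJ = sizeJ ; above = above ; prev = prev ; sizeV = refl } = record
  { p = p′
  ; m = 3 + m
  ; N = 2 + c + suc n₀
  ; isPath = path (subst (λ z → p′ ↭ asc 0 z) eqn (cover π′)) (↭-trans (steps π′) (↭-sym (shift 1 (replicate (2 + c) y) L₀)))
  ; hd = rot-Head prev qs hd
  ; size = trans (sym eqn) (trans (cong (3 +_) size) (sym (trans (+-suc y (2 + m)) (cong suc (+-suc₂ y m)))))
  ; sizeN = refl
  ; bound = ≤-trans (≤-reflexive (cong (2 +_) (sym sizeJ))) (≤-trans (n≤1+n _) (≤-reflexive eqn))
  ; block = Pairs-snoc j (Pairs-map j (λ t le → rotAdj (λ { refl → 1+n≰n (≤-trans (m≤n+m (suc m) 2) le) })) above)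
      (subst (λ z → Adj z p′) (trans (sym size) sizeJ) (inj₁ (rot-new prev qs (there here))))
  ; top = tt }
  where
  qs : List ℕ
  -- As `S = m + 2`, the detour `m`, `y + m`, `y + m + 1`, `y + m + 2`, `S` replaces the edge from
  -- `m` to `m + 1` by two edges of length 1 and two of length `y`. It has to leave from `m`, hence
  -- the directed `prev`. The new endpoint `m + 1` falls below the block, so no single step follows.
  qs = y + m ∷ suc (y + m) ∷ 2 + (y + m) ∷ []
  p′ : List ℕ
  p′ = rot prev qs
  eqn : 3 + (c + n₀) ≡ 2 + c + suc n₀
  eqn = cong (2 +_) (sym (+-suc c n₀))
  turn-gaps : gaps (m ∷ qs ++ 2 + m ∷ []) ↭ ∣ m - suc m ∣ ∷ 1 ∷ y ∷ y ∷ []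
  turn-gaps = ↭-trans (↭-reflexive (cong₂ _∷_ (∣-∣-+ʳ y m) (cong₂ _∷_ (∣n-sucn∣≡1 (y + m)) (cong₂ _∷_ (∣n-sucn∣≡1 (y + m)) (cong (_∷ []) (∣-∣-+ˡ y m))))))
    (↭-trans (↭-sym (shift y (1 ∷ 1 ∷ []) (y ∷ []))) (↭-reflexive (cong (_∷ 1 ∷ y ∷ y ∷ []) (sym (∣n-sucn∣≡1 m)))))
  π′ : Path (3 + (c + n₀)) (1 ∷ y ∷ y ∷ replicate c y ++ L₀) p′
  π′ = extend {k = 3} {E = 1 ∷ y ∷ y ∷ []} π
    (subst (λ z → p′ ↭ z ∷ suc z ∷ 2 + z ∷ p) (sym size) (rot-↭ prev qs))
    (rot-gaps prev qs lst turn-gaps)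
  rotAdj : ∀ {t} → t ≢ m → Adj t p → Adj t p′
  rotAdj ne (inj₁ a) = rot-Cons prev qs (λ e _ → ne e) a
  rotAdj ne (inj₂ a) with rot-Cons prev qs (λ e e′ → 2+n≢n (trans (cong suc (sym e′)) e)) a
  ... | inj₁ r = inj₂ r
  ... | inj₂ r = inj₁ r

replicate-+ : ∀ m n (x : ℕ) → replicate (m + n) x ≡ replicate m x ++ replicate n x
replicate-+ zero n x = refl
replicate-+ (suc m) n x = cong (x ∷_) (replicate-+ m n x)

desc-↭ : ∀ m k → desc m k ↭ asc m k
desc-↭ m k = ↭-reverse (asc m k)

-- Joining two paths at their first vertices

record From (h : ℕ) (L : List ℕ) : Set where
  constructor from
  field
    {n}    : ℕ
    {p}    : List ℕ
    isPath : Path (suc n) L p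
    hd     : Head h p

Lin : List ℕ → Set
Lin L = ∃ λ n → ∃ λ p → Path (suc n) L p

Path-resp : ∀ {n L L′ p} → L ↭ L′ → Path n L p → Path n L′ p
Path-resp e π = path (cover π) (↭-trans (steps π) e)

From-resp : ∀ {h L L′} → L ↭ L′ → From h L → From h L′
From-resp e (from π hd) = from (Path-resp e π) hd

Lin-resp : ∀ {L L′} → L ↭ L′ → Lin L → Lin L′
Lin-resp e (n , p , π) = n , p , Path-resp e π

From⇒Lin : ∀ {h L} → From h L → Lin L
From⇒Lin (from π _) = _ , _ , π

Path-bound : ∀ {n L p} → Path (suc n) L p → All (_≤ n) p
Path-bound {n} π = All-resp-↭ (↭-sym (cover π))
  (All.map (λ {x} lt → ≤-pred (subst (suc x ≤_) (+-identityʳ (suc n)) lt)) (All-asc 0 (suc n)))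

-- The first path is reflected and placed below the second, heads facing each other, so the
-- connecting edge has length `u + 1 + w`. This is why `From` records the head.
linked : ℕ → List ℕ → List ℕ → List ℕ
linked m p q = reverse (map (m ∸_) p) ++ map (suc m +_) q

linked-Path : ∀ {m n u w L M p q} → Path (suc m) L p → Head u p → Path (suc n) M q → Head w q →
  Path (suc m + suc n) (L ++ u + suc w ∷ M) (linked m p q)
linked-Path {m} {n} {u} {w} {L} {M} {p} {q} π hp ρ hq = path cov (↭-trans (↭-reflexive g) (++⁺ gp (↭-prep _ gq)))
  where
  cov : linked m p q ↭ asc 0 (suc m + suc n)
  cov = begin
    reverse (map (m ∸_) p) ++ map (suc m +_) q
      ↭⟨ ++⁺ (↭-trans (↭-reverse _) (map⁺ (m ∸_) (cover π))) (map⁺ (suc m +_) (cover ρ)) ⟩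
    map (m ∸_) (asc 0 (suc m)) ++ map (suc m +_) (asc 0 (suc n))
      ≡⟨ cong₂ _++_ (reflect-asc₀ m) (map-+-asc (suc m) 0 (suc n)) ⟩
    desc 0 (suc m) ++ asc (suc m + 0) (suc n)
      ↭⟨ ++⁺ʳ _ (desc-↭ 0 (suc m)) ⟩
    asc 0 (suc m) ++ asc (suc m + 0) (suc n)
      ≡⟨ sym (asc-++ 0 (suc m) (suc n)) ⟩
    asc 0 (suc m + suc n) ∎
    where open PermutationReasoning
  gp : gaps (reverse (map (m ∸_) p)) ↭ L
  gp = ↭-trans (gaps-reverse _) (↭-trans (↭-reflexive (gaps-reflect m (Path-bound π))) (steps π))
  gq : gaps (map (suc m +_) q) ↭ M
  gq = ↭-trans (↭-reflexive (gaps-shift (suc m) q)) (steps ρ)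
  u≤m : ∀ {p} → Head u p → All (_≤ m) p → u ≤ m
  u≤m head (a ∷ _) = a
  jump : ∣ (m ∸ u) - (suc m + w) ∣ ≡ u + suc w
  jump = trans (cong (λ z → ∣ (m ∸ u) - z ∣) e) (∣m-m+n∣≡n (m ∸ u) (u + suc w))
    where
    e : suc m + w ≡ (m ∸ u) + (u + suc w)
    e = trans (sym (+-suc m w)) (trans (cong (_+ suc w) (sym (m∸n+n≡m (u≤m hp (Path-bound π))))) (+-assoc (m ∸ u) u (suc w)))
  g : gaps (linked m p q) ≡ gaps (reverse (map (m ∸_) p)) ++ (u + suc w) ∷ gaps (map (suc m +_) q)
  g = trans (gaps-++ (Last-reverse (Head-map (m ∸_) hp)) (Head-map (suc m +_) hq))
        (cong (λ z → gaps (reverse (map (m ∸_) p)) ++ z ∷ gaps (map (suc m +_) q)) jump)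

link : ∀ {u w L M} → From u L → From w M → Lin (L ++ u + suc w ∷ M)
link (from π hp) (from ρ hq) = _ , _ , linked-Path π hp ρ hq

-- The two paths share the vertex 0, the first one being reflected.
glued : ℕ → List ℕ → List ℕ → List ℕ
glued m p q = reverse (map (m ∸_) p) ++ map (m +_) q

glued-Path : ∀ {m n L M p q} → Path (suc m) L (0 ∷ p) → Path (suc n) M (0 ∷ q) →
  Path (suc (m + n)) (L ++ M) (glued m p (0 ∷ q))
glued-Path {m} {n} {L} {M} {p} {q} π ρ = path cov (↭-trans (↭-reflexive g) (++⁺ gp gq))
  where
  cov : glued m p (0 ∷ q) ↭ asc 0 (suc (m + n))
  cov = begin
    reverse (map (m ∸_) p) ++ map (m +_) (0 ∷ q)
      ↭⟨ ++⁺ (↭-trans (↭-reverse _) (map⁺ (m ∸_) (drop-∷ (cover π)))) (map⁺ (m +_) (cover ρ)) ⟩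
    map (m ∸_) (asc 1 m) ++ map (m +_) (asc 0 (suc n))
      ≡⟨ cong₂ _++_ (reflect-asc 0 m) (map-+-asc m 0 (suc n)) ⟩
    desc 0 m ++ asc (m + 0) (suc n)
      ↭⟨ ++⁺ʳ _ (desc-↭ 0 m) ⟩
    asc 0 m ++ asc (m + 0) (suc n)
      ≡⟨ sym (asc-++ 0 m (suc n)) ⟩
    asc 0 (m + suc n)
      ≡⟨ cong (asc 0) (+-suc m n) ⟩
    asc 0 (suc (m + n)) ∎
    where open PermutationReasoning
  A : List ℕ
  A = reverse (map (m ∸_) p)
  g : gaps (A ++ map (m +_) (0 ∷ q)) ≡ gaps (reverse (map (m ∸_) (0 ∷ p))) ++ gaps (map (m +_) (0 ∷ q))
  g = trans (gaps-split A (m + 0) (map (m +_) q))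
    (cong (λ z → gaps z ++ gaps (map (m +_) (0 ∷ q)))
      (trans (cong (λ z → A ++ z ∷ []) (+-identityʳ m)) (sym (unfold-reverse m (map (m ∸_) p)))))
  gp : gaps (reverse (map (m ∸_) (0 ∷ p))) ↭ L
  gp = ↭-trans (gaps-reverse _) (↭-trans (↭-reflexive (gaps-reflect m (Path-bound π))) (steps π))
  gq : gaps (map (m +_) (0 ∷ q)) ↭ M
  gq = ↭-trans (↭-reflexive (gaps-shift m (0 ∷ q))) (steps ρ)

glue : ∀ {L M} → From 0 L → From 0 M → Lin (L ++ M)
glue (from π head) (from ρ head) = _ , _ , glued-Path π ρ

Adj-asc : ∀ m k t → m ≤ t → 2 + t ≤ k + m → Adj t (asc m k)
Adj-asc m k t le le′ = inj₁ (Cons-asc m k t le le′)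

Adj-desc : ∀ m k t → m ≤ t → 2 + t ≤ k + m → Adj t (desc m k)
Adj-desc m k t le le′ = Adj-reverse (Adj-asc m k t le le′)

asc-Path : ∀ a → Path (suc a) (replicate a 1) (asc 0 (suc a))
asc-Path a = path ↭-refl (↭-reflexive (gaps-asc 0 a))

-- 0 , … , k , k + d , … , k + 1  with d = suc e
hook : ℕ → ℕ → List ℕ
hook k e = asc 0 (suc k) ++ desc (suc k) (suc e)

hook-Path : ∀ k e → Path (2 + (e + k)) (suc e ∷ replicate (e + k) 1) (hook k e)
hook-Path k e = path cov gp
  where
  open PermutationReasoning
  cov : hook k e ↭ asc 0 (2 + (e + k))
  cov = begin
    asc 0 (suc k) ++ desc (suc k) (suc e)
      ↭⟨ ++⁺ˡ (asc 0 (suc k)) (desc-↭ (suc k) (suc e)) ⟩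
    asc 0 (suc k) ++ asc (suc k) (suc e)
      ≡⟨ cong (λ z → asc 0 (suc k) ++ asc z (suc e)) (sym (+-identityʳ (suc k))) ⟩
    asc 0 (suc k) ++ asc (suc k + 0) (suc e)
      ≡⟨ sym (asc-++ 0 (suc k) (suc e)) ⟩
    asc 0 (suc k + suc e)
      ≡⟨ cong (asc 0) (trans (+-suc (suc k) e) (cong (2 +_) (+-comm k e))) ⟩
    asc 0 (2 + (e + k)) ∎
  jump : ∣ k + 0 - e + suc k ∣ ≡ suc e
  jump = trans (cong₂ ∣_-_∣ (+-identityʳ k) (+-suc e k)) (∣-∣-+ʳ (suc e) k)
  gp : gaps (hook k e) ↭ suc e ∷ replicate (e + k) 1
  gp = begin
    gaps (hook k e)
      ≡⟨ gaps-++ (Last-asc 0 k) (Head-desc (suc k) e) ⟩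
    gaps (asc 0 (suc k)) ++ ∣ k + 0 - e + suc k ∣ ∷ gaps (desc (suc k) (suc e))
      ≡⟨ cong₂ (λ a b → a ++ b ∷ gaps (desc (suc k) (suc e))) (gaps-asc 0 k) jump ⟩
    replicate k 1 ++ suc e ∷ gaps (desc (suc k) (suc e))
      ↭⟨ shift (suc e) (replicate k 1) _ ⟩
    suc e ∷ replicate k 1 ++ gaps (desc (suc k) (suc e))
      ↭⟨ ↭-prep _ (++⁺ˡ _ (gaps-desc (suc k) e)) ⟩
    suc e ∷ replicate k 1 ++ replicate e 1
      ≡⟨ cong (suc e ∷_) (trans (sym (replicate-+ k e 1)) (cong (λ z → replicate z 1) (+-comm k e))) ⟩
    suc e ∷ replicate (e + k) 1 ∎

≤+0 : ∀ {a b} → a ≤ b → a ≤ b + 0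
≤+0 {a} {b} = subst (a ≤_) (sym (+-identityʳ b))

toFrom : ∀ {h n L p} → Path n L p → Head h p → From h L
toFrom {n = zero} π (head {p}) with ↭-length (cover π)
... | ()
toFrom {n = suc n} π hd = from π hd

castOdd : ∀ {y h n₀ L₀ i i′ j c} → i ≡ i′ → Odd y h n₀ L₀ i j c → Odd y h n₀ L₀ i′ j c
castOdd refl O = O

castFan : ∀ {y h n₀ L₀ r r′ l c} → r ≡ r′ → Fan y h n₀ L₀ r l c → Fan y h n₀ L₀ r′ l c
castFan refl F = F

-- Two lengths

data Parity : ℕ → Set where
  double  : ∀ k → Parity (k * 2)
  double+1 : ∀ k → Parity (suc (k * 2))

evenOrOdd : ∀ n → Parity n
evenOrOdd zero = double 0
evenOrOdd (suc n) with evenOrOdd n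
... | double k = double+1 k
... | double+1 k = double (suc k)

-- Growth adds edges in twos, so each parity of the multiplicity needs a start of its own; both
-- starts cost one edge less than the length.
evenBase₀ : ∀ g k → let a = suc (g * 2) + k in Even (suc g) 0 (suc a) (replicate a 1) 0
evenBase₀ g k = record
  { m = k
  ; isPath = asc-Path (suc (g * 2) + k)
  ; hd = head
  ; size = refl
  ; block = Pairs-intro (suc g) (λ t _ le → Adj-asc 0 _ t z≤n (≤+0 le)) }

evenBase₁ : ∀ g k → let a = suc (g * 2) + k in Even (suc g) 0 (suc a) (replicate a 1) 1
evenBase₁ g k = record
  { m = suc k
  ; isPath = hook-Path k (suc (g * 2))
  ; hd = head
  ; size = sym (+-suc (suc g * 2) k)
  ; block = Pairs-intro (suc g) (λ t le le′ → Adj-++ˡ (asc 0 (suc k)) (Adj-desc (suc k) (suc g * 2) t le le′)) }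

evenFrom : ∀ {g h n₀ L₀ c} → Even g h n₀ L₀ c → From h (L₀ ++ replicate c (g * 2))
evenFrom {g} {L₀ = L₀} {c} E = From-resp (++-comm (replicate c (g * 2)) L₀) (toFrom (Even.isPath E) (Even.hd E))

oddFrom : ∀ {y h n₀ L₀ i j c} → Odd y h n₀ L₀ i j c → From h (L₀ ++ replicate c y)
oddFrom {y} {L₀ = L₀} {c = c} E = From-resp (++-comm (replicate c y) L₀) (toFrom (Odd.isPath E) (Odd.hd E))

fanFrom : ∀ {y h n₀ L₀ r l c} → Fan y h n₀ L₀ r l c → From h (L₀ ++ replicate c y)
fanFrom {y} {L₀ = L₀} {c = c} E = From-resp (++-comm (replicate c y) L₀) (toFrom (Fan.isPath E) (Fan.hd E))

stdEven : ∀ g k c → From 0 (replicate (suc (g * 2) + k) 1 ++ replicate c (suc g * 2))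
stdEven g k c with evenOrOdd c
... | double j = subst (λ z → From 0 (replicate (suc (g * 2) + k) 1 ++ replicate z (suc g * 2))) (+-identityʳ (j * 2))
  (evenFrom (evenGrow j (evenBase₀ g k)))
... | double+1 j = subst (λ z → From 0 (replicate (suc (g * 2) + k) 1 ++ replicate z (suc g * 2))) (+-comm (j * 2) 1)
  (evenFrom (evenGrow j (evenBase₁ g k)))

oddBase : ∀ h k → let a = suc h * 2 + k in Odd (suc (suc h * 2)) 0 (suc a) (replicate a 1) (suc h) 0 0
oddBase h k = record
  { m = k
  ; S = suc h * 2 + k
  ; V = h * 2 + k
  ; isPath = asc-Path (suc h * 2 + k)
  ; hd = head
  ; lst = subst (λ z → Last z (asc 0 (suc (suc h * 2 + k)))) (+-identityʳ _) (Last-asc 0 (suc h * 2 + k))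
  ; size = refl
  ; sizeS = refl
  ; sizeJ = refl
  ; below = Pairs-intro (suc h) (λ t _ le → Adj-asc 0 _ t z≤n (≤+0 (≤-trans le (n≤1+n _))))
  ; above = tt
  ; prev = Cons-asc 0 _ _ z≤n (≤+0 (n≤1+n _))
  ; sizeV = refl }

-- The even residues `2 j` modulo `y`: `q` rounds followed by `j` pair steps.
stdGood : ∀ h k q i j → j + i ≡ suc h →
  From 0 (replicate (suc h * 2 + k) 1 ++ replicate (j * 2 + (q * suc (suc h * 2) + 0)) (suc (suc h * 2)))
stdGood h k q i j eq = oddFrom (pairSteps {i = i} {j = 0} j
  (castOdd (sym eq) (rounds (suc h) 0 h q (+-identityʳ (suc h)) (oddBase h k))))

-- The hook contains one edge of length `y` and leaves `h + 1` pairs, each good for two more. So odd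
-- multiplicities up to `y` need no turn.
hookFan : ∀ h k → let a = suc h * 2 + k in Fan (suc (suc h * 2)) 0 (suc a) (replicate a 1) (suc h) 0 1
hookFan h k = record
  { m = suc k
  ; N = 2 + (suc h * 2 + k)
  ; isPath = hook-Path k (suc h * 2)
  ; hd = head
  ; size = cong suc (sym (+-suc (suc h * 2) k))
  ; sizeN = refl
  ; bound = ≤-trans (≤-reflexive (+-suc (suc h * 2) k)) (n≤1+n _)
  ; block = Pairs-intro (suc h) (λ t le le′ → Adj-++ˡ (asc 0 (suc k)) (Adj-desc (suc k) (suc (suc h * 2)) t le (≤-trans le′ (n≤1+n _))))
  ; top = tt }

stdSmall : ∀ h k i j → j + i ≡ suc h →
  From 0 (replicate (suc h * 2 + k) 1 ++ replicate (j * 2 + 1) (suc (suc h * 2)))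
stdSmall h k i j eq = fanFrom (fanSteps {r = i} {l = 0} j (castFan (sym eq) (hookFan h k)))

-- After `q` rounds, `h` pair steps leave the one pair below `S` that `turn` asks for. As
-- `y = 2 h + 3`, the multiplicity reached is `(q + 1) y + 2 j - 1`.
turnOdd : ∀ {hd n₀ L₀} h q i j → j + i ≡ suc h → let y = suc (suc h * 2) in
  Odd y hd n₀ L₀ (suc h) 0 0 → Fan y hd (suc n₀) (1 ∷ L₀) i (j + 0) (j * 2 + (2 + (h * 2 + (q * y + 0))))
turnOdd h q i j eq O = fanSteps {r = i} {l = 0} j (castFan (trans (cong suc (+-identityʳ h)) (sym eq))
  (turn (pairSteps {i = 1} {j = 0} h (castOdd (+-comm 1 h) (rounds (suc h) 0 h q (+-identityʳ (suc h)) O)))))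

turnedFan : ∀ h k q i j → j + i ≡ suc h → let a = suc h * 2 + k; y = suc (suc h * 2) in
  Fan y 0 (2 + a) (replicate (suc a) 1) i (j + 0) (j * 2 + (2 + (h * 2 + (q * y + 0))))
turnedFan h k q i j eq = turnOdd h q i j eq (oddBase h k)

-- With y = 2 h + 3, a tight count c needs only y - 1 edges of length 1 and a bad one needs y.
data Count (h c : ℕ) : Set where
  tight : (∀ k → From 0 (replicate (suc h * 2 + k) 1 ++ replicate c (suc (suc h * 2)))) → Count h c
  bad   : ∀ q i j → suc j + i ≡ suc h → c ≡ suc j * 2 + (2 + (h * 2 + (q * suc (suc h * 2) + 0))) → Count h c

castCount : ∀ u a y {c c′} → c ≡ c′ → From u (replicate a 1 ++ replicate c y) → From u (replicate a 1 ++ replicate c′ y)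
castCount u a y refl F = F

half-≤ : ∀ j h → j * 2 ≤ h * 2 → j ≤ h
half-≤ j h = *-cancelʳ-≤ j h 2

-- Division by `y`: an even remainder is tight by `stdGood`, an odd one with quotient 0 by the hook.
-- What is left is `(q + 1) y + 2 j + 1`, written in `bad` in the form that `turnOdd` produces.
count : ∀ h c → Count h c
count h c with c % y | c / y | m≡m%n+[m/n]*n c y | m%n<n c y
  where
  y : ℕ
  y = suc (suc h * 2)
... | e | q | eq | s≤s lt with evenOrOdd e
... | double j = tight λ k → castCount 0 (suc h * 2 + k) (suc (suc h * 2))
  (sym (trans eq (cong (j * 2 +_) (sym (+-identityʳ _)))))
  (stdGood h k q (suc h ∸ j) j (m+[n∸m]≡n (half-≤ j (suc h) lt)))
... | double+1 j with q
... | zero = tight λ k → castCount 0 (suc h * 2 + k) (suc (suc h * 2)) (sym (trans eq (lem j)))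
  (stdSmall h k (suc h ∸ j) j (m+[n∸m]≡n (half-≤ j (suc h) (≤-trans (n≤1+n _) lt))))
  where
  lem : ∀ j → suc (j * 2) + 0 ≡ j * 2 + 1
  lem = solve-∀
... | suc q = bad q (h ∸ j) j (cong suc (m+[n∸m]≡n (≤-pred (*-cancelʳ-< 2 j (suc h) lt)))) (trans eq (lem j h q))
  where
  lem : ∀ j h q → suc (j * 2) + suc q * suc (suc h * 2) ≡ suc j * 2 + (2 + (h * 2 + (q * suc (suc h * 2) + 0)))
  lem = solve-∀

-- Paths with a prescribed first vertex

wrap-Path : ∀ s k → Path (suc (k + suc s)) (k + suc s ∷ replicate (k + s) 1) (asc (suc s) (suc k) ++ asc 0 (suc s))
wrap-Path s k = path (asc-extend (suc s) (suc k)) (begin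
  gaps (asc (suc s) (suc k) ++ asc 0 (suc s))
    ≡⟨ gaps-++ (Last-asc (suc s) k) head ⟩
  gaps (asc (suc s) (suc k)) ++ ∣ k + suc s - 0 ∣ ∷ gaps (asc 0 (suc s))
    ≡⟨ cong₂ _++_ (gaps-asc (suc s) k) (cong₂ _∷_ (∣-∣-identityʳ (k + suc s)) (gaps-asc 0 s)) ⟩
  replicate k 1 ++ k + suc s ∷ replicate s 1
    ↭⟨ shift _ (replicate k 1) _ ⟩
  k + suc s ∷ replicate k 1 ++ replicate s 1
    ≡⟨ cong (k + suc s ∷_) (sym (replicate-+ k s 1)) ⟩
  k + suc s ∷ replicate (k + s) 1 ∎)
  where open PermutationReasoning

-- Moving the cut `s` moves the head, which later sets the length of a linking edge, while the price
-- stays at one less than the odd length.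
wrapOdd : ∀ i j → let s = suc (i * 2); k = suc (j * 2) in
  Odd (k + suc s) (suc s) (k + suc s) (replicate (k + s) 1) i (suc j) 1
wrapOdd i j = record
  { m = 1
  ; isPath = wrap-Path s k
  ; hd = head
  ; lst = Last-++ʳ (asc (suc s) (suc k)) (subst (λ z → Last z (asc 0 (suc s))) (+-identityʳ s) (Last-asc 0 s))
  ; size = +-comm 1 (k + suc s)
  ; sizeS = +-comm 1 (i * 2)
  ; sizeJ = refl
  ; below = Pairs-intro i (λ t _ le → Adj-++ˡ (asc (suc s) (suc k)) (Adj-asc 0 (suc s) t z≤n
      (≤+0 (≤-trans le (≤-trans (≤-reflexive (+-comm (i * 2) 1)) (n≤1+n _))))))
  ; above = Pairs-intro (suc j) (λ t le le′ → Adj-++ʳ (asc 0 (suc s)) (Adj-asc (suc s) (suc k) t le le′))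
  ; prev = proj₁ (proj₂ (pr i))
  ; sizeV = proj₂ (proj₂ (pr i)) }
  where
  s k : ℕ
  s = suc (i * 2)
  k = suc (j * 2)
  pr : ∀ i → let s = suc (i * 2) in
    ∃ λ V → Cons V (suc V) (asc (suc s) (suc k) ++ asc 0 (suc s)) × 2 + V ≡ precedes i s (suc (k + suc s))
  pr zero = j * 2 + 2 , Cons-++ʳ _ (Cons-asc 2 (suc k) _ (m≤n+m 2 (j * 2)) ≤-refl) , refl
  pr (suc i) = suc (i * 2) , Cons-++ˡ (asc _ (suc k)) (Cons-asc 0 _ _ z≤n (≤+0 (n≤1+n _))) , refl

wrapOdd′ : ∀ i j l → i + suc j ≡ suc l →
  Odd (suc (suc l * 2)) (suc i * 2) (suc (suc l * 2)) (replicate (suc l * 2) 1) i (suc j) 1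
wrapOdd′ i j l eq = subst₂ (λ y a → Odd y (suc i * 2) y (replicate a 1) i (suc j) 1)
  (trans (lem i j) (cong (λ z → suc (z * 2)) eq)) (trans (lem′ i j) (cong (_* 2) eq)) (wrapOdd i j)
  where
  lem : ∀ i j → suc (j * 2) + suc (suc (i * 2)) ≡ suc ((i + suc j) * 2)
  lem = solve-∀
  lem′ : ∀ i j → suc (j * 2) + suc (i * 2) ≡ (i + suc j) * 2
  lem′ = solve-∀

-- The start already contains one edge of length `y`, so odd residues `2 a + 1` are had for `y - 1`
-- ones whatever `q` is. In exchange the head is not 0, and `a` is bounded by the number of pairs
-- below `S`.
startPlain : ∀ i j l q a b → i + suc j ≡ suc l → a + b ≡ i → let y = suc (suc l * 2) in
  From (suc i * 2) (replicate (suc l * 2) 1 ++ replicate (a * 2 + (q * y + 1)) y)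
startPlain i j l q a b eq eq′ =
  oddFrom (pairSteps {i = b} a (castOdd (sym eq′) (rounds i (suc j) l q eq (wrapOdd′ i j l eq))))

-- Residues `2 (a + i) + 3`: those past `2 i + 3` are out of reach of `startPlain` with the same
-- head, and the turn pays for them with one more edge of length 1.
startTurned : ∀ i j l q a b → suc i + suc j ≡ suc l → a + b ≡ suc l → let y = suc (suc l * 2) in
  From (2 + suc i * 2) (replicate (suc (suc l * 2)) 1 ++ replicate (a * 2 + (2 + (i * 2 + (q * y + 1)))) y)
startTurned i j l q a b eq eq′ =
  fanFrom (fanSteps {r = b} a (castFan (trans eq (sym eq′)) (turn (pairSteps {i = 1} i
    (castOdd (+-comm 1 i) (rounds (suc i) (suc j) l q eq (wrapOdd′ (suc i) j l eq)))))))

-- Detours over the top edge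

ins-new : ∀ {u w p a b} (c : Cons u w p) qs → Cons a b (u ∷ qs ++ w ∷ []) → Cons a b (ins c qs)
ins-new {u} {w} (here {p}) qs c′ = subst (Cons _ _) (cong (u ∷_) (++-assoc qs (w ∷ []) p)) (Cons-++ʳ p c′)
ins-new (there c) qs c′ = there (ins-new c qs c′)

Path-reverse : ∀ {n L p} → Path n L p → Path n L (reverse p)
Path-reverse {p = p} π = path (↭-trans (↭-reverse p) (cover π)) (↭-trans (gaps-reverse p) (steps π))

-- Removing the edge from `t` to `t + 1` refunds one edge of length 1, so a fresh block for the
-- length `x = e + 2` costs `x - 2` instead of the `x - 1` of a glued path.
crestUp : ∀ {n L p t} e → Path n L p → n ≡ 2 + t → Cons t (suc t) p → ∃ λ p′ →
  Path (suc e + n) (2 + e ∷ replicate e 1 ++ L) p′ × (∀ u → suc t ≤ u → 2 + u ≤ 2 + e + suc t → Adj u p′)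
crestUp {n} {L} {p} {t} e π refl c = ins c qs
  , extend {k = suc e} {E = 2 + e ∷ replicate e 1} π
      (↭-trans (ins-↭ c qs) (++⁺ʳ p (desc-↭ (2 + t) (suc e))))
      (ins-gaps c qs crest-gaps)
  , λ u le le′ → Adj-map (λ c′ → ins-new c qs (there c′))
      (subst (Adj u) (unfold-reverse (suc t) (asc (2 + t) (suc e))) (Adj-desc (suc t) (2 + e) u le le′))
  where
  qs : List ℕ
  qs = desc (2 + t) (suc e)
  jump : ∣ t - (e + (2 + t)) ∣ ≡ 2 + e
  jump = trans (cong (∣ t -_∣) (+-suc₂ e t)) (∣-∣-+ʳ (2 + e) t)
  crest-gaps : gaps (t ∷ qs ++ suc t ∷ []) ↭ ∣ t - suc t ∣ ∷ 2 + e ∷ replicate e 1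
  crest-gaps = begin
    gaps (t ∷ qs ++ suc t ∷ [])
      ≡⟨ gaps-∷ (Head-++ _ (Head-desc (2 + t) e)) ⟩
    ∣ t - (e + (2 + t)) ∣ ∷ gaps (qs ++ suc t ∷ [])
      ≡⟨ cong₂ _∷_ jump (gaps-++ (Last-reverse {2 + t} {asc (2 + t) (suc e)} head) head) ⟩
    2 + e ∷ gaps qs ++ ∣ 2 + t - suc t ∣ ∷ []
      ↭⟨ ↭-prep _ (++-comm (gaps qs) _) ⟩
    2 + e ∷ ∣ 2 + t - suc t ∣ ∷ gaps qs
      ↭⟨ ↭-swap _ _ (gaps-desc (2 + t) e) ⟩
    ∣ 2 + t - suc t ∣ ∷ 2 + e ∷ replicate e 1
      ≡⟨ cong (_∷ 2 + e ∷ replicate e 1) (∣-∣-comm (suc t) t) ⟩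
    ∣ t - suc t ∣ ∷ 2 + e ∷ replicate e 1 ∎
    where open PermutationReasoning

-- The top edge {t, t + 1} is replaced by the detour t, t + x, t + x - 1, … , t + 1 with x = e + 2.
crest : ∀ {n L p t} e → Path n L p → n ≡ 2 + t → Adj t p → ∃ λ p′ →
  Path (suc e + n) (2 + e ∷ replicate e 1 ++ L) p′ × (∀ u → suc t ≤ u → 2 + u ≤ 2 + e + suc t → Adj u p′)
crest e π eq (inj₁ c) = crestUp e π eq c
crest e π eq (inj₂ c) = crestUp e (Path-reverse π) eq (Cons-reverse c)

-- Growth by edges of length 3, the last vertex lying above (High) or below (Low) the pair.  The pair
-- 1, 2 has to survive because it becomes the lowest pair of the block of the second length.
record High (c : ℕ) : Set where
  field
    p      : List ℕ
    isPath : Path (c + 3) (replicate c 3 ++ 1 ∷ 1 ∷ []) p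
    hd     : Head 0 p
    lst    : Last (2 + c) p
    pair   : Adj c p
    kept   : Adj 1 p
    c≢1    : c ≢ 1

record Low (c : ℕ) : Set where
  field
    p      : List ℕ
    isPath : Path (c + 3) (replicate c 3 ++ 1 ∷ 1 ∷ []) p
    hd     : Head 0 p
    lst    : Last c p
    pair   : Adj (suc c) p
    kept   : Adj 1 p
    c≢0    : c ≢ 0

-- The pair that is grown is `c`, `c + 1`; by `c≢1` it is not the pair 1, 2 that must survive.
lower : ∀ {c} → High c → Low (2 + c)
lower {c} record { isPath = π ; hd = hd ; lst = lst ; pair = pair ; kept = kept ; c≢1 = c≢1 } with grow 3 pair
... | p′ , G , new = record
  { isPath = Grown-Path (+-comm c 3) π G ; hd = keepHead G hd ; lst = keepLast G lst
  ; pair = new ; kept = keep G (λ e → c≢1 (sym e)) kept ; c≢0 = λ () }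

raise : ∀ {c} → Low c → High (suc c)
raise {c} record { p = p ; isPath = π ; hd = hd ; lst = lst ; pair = pair ; kept = kept ; c≢0 = c≢0 } = record
  { isPath = extend {k = 1} {E = 3 ∷ []} π (++-comm p _)
      (↭-trans (snoc-gaps _ lst) (↭-reflexive (cong (_∷ gaps p) (∣m-m+n∣≡n c 3))))
  ; hd = Head-++ _ hd ; lst = subst (λ z → Last z (p ++ c + 3 ∷ [])) (+-comm c 3) (Last-++ʳ p last)
  ; pair = Adj-++ʳ _ pair ; kept = Adj-++ʳ _ kept ; c≢1 = λ e → c≢0 (suc-injective e) }

low₁ : Low 1
low₁ = record { p = hook 0 2 ; isPath = hook-Path 0 2 ; hd = head ; lst = later (later (later last))
    ; pair = inj₂ (there here) ; kept = inj₂ (there (there here)) ; c≢0 = λ () }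

threes : ∀ b → High b ⊎ Low b
threes 0 = inj₁ (record { p = 0 ∷ 1 ∷ 2 ∷ [] ; isPath = path ↭-refl ↭-refl ; hd = head ; lst = later (later last)
  ; pair = inj₁ here ; kept = inj₁ (there here) ; c≢1 = λ () })
threes 1 = inj₂ low₁
threes 2 = inj₁ (raise low₁)
threes (suc (suc (suc b))) with threes b
... | inj₁ h = inj₁ (raise (lower h))
... | inj₂ l = inj₂ (lower (raise l))

record Three (b : ℕ) : Set where
  field
    p      : List ℕ
    isPath : Path (suc (2 + b)) (replicate b 3 ++ 1 ∷ 1 ∷ []) (0 ∷ p)
    kept   : Adj 1 (0 ∷ p)

three : ∀ b → Three b
three b with threes b
... | inj₁ record { isPath = π ; hd = head ; kept = kept } =
  record { isPath = castPath (+-comm b 3) π ; kept = kept }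
... | inj₂ record { isPath = π ; hd = head ; kept = kept } =
  record { isPath = castPath (+-comm b 3) π ; kept = kept }

threeFrom : ∀ b → From 0 (replicate 2 1 ++ replicate b 3)
threeFrom b = From-resp (++-comm (replicate b 3) _) (from (Three.isPath (three b)) head)

-- Reflection moves the pair 1, 2 to `b`, `b + 1`, just below the ascending part that begins at
-- `b + 2`. Together they form the block for `y`, so both lengths share one path with only `y - 1`
-- ones.
threeOdd : ∀ l b → let y = suc ((2 + l) * 2) in ∃ λ h →
  Odd y h (y + b) ((replicate b 3 ++ 1 ∷ 1 ∷ []) ++ replicate (2 + l * 2) 1) (2 + l) 0 0
threeOdd l b with three b
... | record { p = p ; isPath = π ; kept = kept } = proj₁ hd , record
  { m = b
  ; S = (2 + l) * 2 + b
  ; V = suc l * 2 + b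
  ; isPath = castPath (lem b l) (glued-Path π (asc-Path (2 + l * 2)))
  ; hd = proj₂ hd
  ; lst = subst (Last _) (sym q≡) (Last-++ʳ A (subst (λ z → Last z (asc (2 + b) (3 + l * 2))) (+-suc₂ (2 + l * 2) b) (Last-asc (2 + b) (2 + l * 2))))
  ; size = refl
  ; sizeS = refl
  ; sizeJ = refl
  ; below = subst (λ z → Pairs z b (2 + l)) (sym q≡)
      ( joint kept
      , Pairs-intro (suc l) λ t le le′ → Adj-++ˡ A (Adj-asc (2 + b) (3 + l * 2) t le (≤-trans le′ (n≤1+n _))))
  ; above = tt
  ; prev = prev
  ; sizeV = refl }
  where
  A q : List ℕ
  A = reverse (map (2 + b ∸_) p)
  q = glued (2 + b) p (asc 0 (3 + l * 2))
  q≡ : q ≡ A ++ asc (2 + b) (3 + l * 2)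
  q≡ = cong (A ++_) (trans (map-+-asc (2 + b) 0 (3 + l * 2)) (cong (λ z → asc z (3 + l * 2)) (+-identityʳ (2 + b))))
  lem : ∀ b l → suc (2 + b + (2 + l * 2)) ≡ suc ((2 + l) * 2) + b
  lem = solve-∀
  joint : Adj 1 (0 ∷ p) → Adj b (A ++ asc (2 + b) (3 + l * 2))
  joint (inj₁ (there c)) = inj₁ (Cons-++ʳ _ (Cons-reverse (Cons-map (2 + b ∸_) c)))
  joint (inj₂ (there c)) = inj₂ (Cons-++ʳ _ (Cons-reverse (Cons-map (2 + b ∸_) c)))
  prev : Cons (suc l * 2 + b) (suc (suc l * 2 + b)) q
  prev = subst (Cons _ _) (sym q≡) (Cons-++ˡ A (Cons-asc (2 + b) (3 + l * 2) _ (s≤s (s≤s (m≤n+m b (l * 2))))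
    (≤-trans (≤-reflexive (cong (2 +_) (sym (+-suc₂ (l * 2) b)))) (n≤1+n _))))
  hd : ∃ λ h → Head h q
  hd = Cons⇒Head prev

++-commutativeMonoid : CommutativeMonoid 0ℓ 0ℓ
++-commutativeMonoid = record { isCommutativeMonoid = ++-isCommutativeMonoid {A = ℕ} }

module ++-Solver = Algebra.Solver.CommutativeMonoid ++-commutativeMonoid
open ++-Solver using (_⊕_; _⊜_)

-- Three lengths

glue3 : ∀ {a₁ a₂ a} b c x y → From 0 (replicate a₁ 1 ++ replicate b x) → From 0 (replicate a₂ 1 ++ replicate c y) →
  a₁ + a₂ ≡ a → Lin (L3 a b c x y)
glue3 {a₁} {a₂} b c x y F G refl = Lin-resp (↭-trans
  (++-Solver.solve 4 (λ p q r s → (p ⊕ r) ⊕ (q ⊕ s) ⊜ (p ⊕ q) ⊕ r ⊕ s) ↭-refl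
    (replicate a₁ 1) (replicate a₂ 1) (replicate b x) (replicate c y))
  (↭-reflexive (cong (_++ replicate b x ++ replicate c y) (sym (replicate-+ a₁ a₂ 1)))))
  (glue F G)

-- The linking edge is itself one of the edges of length `x`, which changes the parity of the number
-- still to be realized.
link3 : ∀ {a₁ a₂ a u w} b c x y → From u (replicate a₁ 1 ++ replicate b x) → From w (replicate a₂ 1 ++ replicate c y) →
  u + suc w ≡ x → a₁ + a₂ ≡ a → Lin (L3 a (suc b) c x y)
link3 {a₁} {a₂} b c x y F G refl refl = Lin-resp (↭-trans
  (++-Solver.solve 5 (λ p q r s t → (p ⊕ r) ⊕ t ⊕ (q ⊕ s) ⊜ (p ⊕ q) ⊕ (t ⊕ r) ⊕ s) ↭-refl
    (replicate a₁ 1) (replicate a₂ 1) (replicate b x) (replicate c y) (x ∷ []))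
  (↭-reflexive (cong (_++ (x ∷ replicate b x) ++ replicate c y) (sym (replicate-+ a₁ a₂ 1)))))
  (link F G)

-- Pairs at the top of a path can serve as a block for a smaller even length: the lower `d` pairs
-- are forgotten and all edges so far are booked in `L`.
subEven : ∀ {h n L p N} d g → Path n L p → Head h p → n ≡ (d + suc g) * 2 + N → Pairs p N (d + suc g) → Even (suc g) h n L 0
subEven {N = N} d g π hd e ps = record
  { m = d * 2 + N
  ; isPath = π
  ; hd = hd
  ; size = trans e (lem d g N)
  ; block = Pairs-drop d (suc g) ps }
  where
  lem : ∀ d g N → (d + suc g) * 2 + N ≡ suc g * 2 + (d * 2 + N)
  lem = solve-∀

crestEven : ∀ g {n L p t} → Path n L p → n ≡ 2 + t → Adj t p →
  ∃ λ h → Even (suc g) h (g * 2 + n) (replicate (g * 2) 1 ++ L) 1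
crestEven g {t = t} π refl a with crest (g * 2) π refl a
... | p′ , π′ , adj = _ , record
  { m = suc t
  ; isPath = π′
  ; hd = proj₂ (hd (adj (suc t) ≤-refl (s≤s (s≤s (m≤n+m (suc t) (g * 2))))))
  ; size = cong suc (+-suc (g * 2) (suc t))
  ; block = Pairs-intro (suc g) adj }
  where
  hd : ∀ {u p} → Adj u p → ∃ λ h → Head h p
  hd (inj₁ c) = Cons⇒Head c
  hd (inj₂ c) = Cons⇒Head c

fanTop : ∀ {y h n₀ L₀ r l c} (F : Fan y h n₀ L₀ r (suc l) c) → ∃ λ t → c + n₀ ≡ 2 + t × Adj t (Fan.p F)
fanTop {l = l} F = l * 2 + Fan.N F , Fan.sizeN F ,
  proj₁ (Pairs-drop l 1 (subst (Pairs (Fan.p F) (Fan.N F)) (+-comm 1 l) (Fan.top F)))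

growLin : ∀ {g h n L c} k {M} → Even (suc g) h n L c → L ++ replicate (k * 2 + c) (suc g * 2) ↭ M → Lin M
growLin k E e = Lin-resp e (From⇒Lin (evenFrom (evenGrow k E)))

castL3 : ∀ a x y {b b′ c c′} → b ≡ b′ → c ≡ c′ → Lin (L3 a b c x y) → Lin (L3 a b′ c′ x y)
castL3 a x y refl refl l = l

stdOdd : ∀ h k c → From 0 (replicate (suc (suc h * 2 + k)) 1 ++ replicate c (suc (suc h * 2)))
stdOdd h k c with count h c
... | tight F = subst (λ z → From 0 (replicate z 1 ++ replicate c (suc (suc h * 2)))) (+-suc (suc h * 2) k) (F (suc k))
... | bad q i j eq e = castCount 0 (suc (suc h * 2 + k)) (suc (suc h * 2)) (sym e) (fanFrom (turnedFan h k q i (suc j) eq))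

-- 0, … , k, then a descent to x + k + 1, then k + 1, … , k + x  with x = e + 1
module _ (k ρ e : ℕ) where
  zigzag : List ℕ
  zigzag = asc 0 (suc k) ++ desc (suc e + suc k) (suc ρ) ++ asc (suc k) (suc e)

  zigzag-Path : Path (suc (k + (suc e + suc ρ))) (suc ρ + suc e ∷ suc e ∷ replicate (k + (ρ + e)) 1) zigzag
  zigzag-Path = path cov gp
    where
    open PermutationReasoning
    cov : zigzag ↭ asc 0 (suc k + (suc e + suc ρ))
    cov = begin
      zigzag
        ↭⟨ ++⁺ˡ (asc 0 (suc k)) (↭-trans (++⁺ʳ (asc (suc k) (suc e)) (desc-↭ (suc e + suc k) (suc ρ))) (++-comm (asc (suc e + suc k) (suc ρ)) _)) ⟩
      asc 0 (suc k) ++ asc (suc k) (suc e) ++ asc (suc e + suc k) (suc ρ)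
        ≡⟨ cong (asc 0 (suc k) ++_) (sym (asc-++ (suc k) (suc e) (suc ρ))) ⟩
      asc 0 (suc k) ++ asc (suc k) (suc e + suc ρ)
        ≡⟨ cong (λ z → asc 0 (suc k) ++ asc z (suc e + suc ρ)) (sym (+-identityʳ (suc k))) ⟩
      asc 0 (suc k) ++ asc (suc k + 0) (suc e + suc ρ)
        ≡⟨ sym (asc-++ 0 (suc k) (suc e + suc ρ)) ⟩
      asc 0 (suc k + (suc e + suc ρ)) ∎
    jump₁ : ∣ k + 0 - (ρ + (suc e + suc k)) ∣ ≡ suc ρ + suc e
    jump₁ = trans (cong₂ ∣_-_∣ (+-identityʳ k) (lem ρ e k)) (∣-∣-+ʳ (suc ρ + suc e) k)
      where
      lem : ∀ ρ e k → ρ + (suc e + suc k) ≡ suc ρ + suc e + k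
      lem = solve-∀
    gp : gaps zigzag ↭ suc ρ + suc e ∷ suc e ∷ replicate (k + (ρ + e)) 1
    gp = begin
      gaps zigzag
        ≡⟨ gaps-++ (Last-asc 0 k) (Head-++ _ (Head-desc (suc e + suc k) ρ)) ⟩
      gaps (asc 0 (suc k)) ++ ∣ k + 0 - (ρ + (suc e + suc k)) ∣ ∷ gaps (desc (suc e + suc k) (suc ρ) ++ asc (suc k) (suc e))
        ≡⟨ cong₂ (λ a b → a ++ b ∷ gaps (desc (suc e + suc k) (suc ρ) ++ asc (suc k) (suc e))) (gaps-asc 0 k) jump₁ ⟩
      replicate k 1 ++ suc ρ + suc e ∷ gaps (desc (suc e + suc k) (suc ρ) ++ asc (suc k) (suc e))
        ≡⟨ cong (λ z → replicate k 1 ++ suc ρ + suc e ∷ z) (gaps-++ (Last-reverse {suc e + suc k} {asc (suc e + suc k) (suc ρ)} head) head) ⟩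
      replicate k 1 ++ suc ρ + suc e ∷ gaps (desc (suc e + suc k) (suc ρ)) ++ ∣ suc e + suc k - suc k ∣ ∷ gaps (asc (suc k) (suc e))
        ↭⟨ ++⁺ˡ (replicate k 1) (↭-prep _ (++⁺ (gaps-desc (suc e + suc k) ρ) (↭-reflexive (cong₂ _∷_ (∣-∣-+ˡ (suc e) (suc k)) (gaps-asc (suc k) e))))) ⟩
      replicate k 1 ++ (suc ρ + suc e ∷ []) ++ replicate ρ 1 ++ (suc e ∷ []) ++ replicate e 1
        ↭⟨ ++-Solver.solve 5 (λ p q r s t → p ⊕ q ⊕ r ⊕ s ⊕ t ⊜ q ⊕ s ⊕ p ⊕ r ⊕ t) ↭-refl
            (replicate k 1) (suc ρ + suc e ∷ []) (replicate ρ 1) (suc e ∷ []) (replicate e 1) ⟩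
      suc ρ + suc e ∷ suc e ∷ replicate k 1 ++ replicate ρ 1 ++ replicate e 1
        ≡⟨ cong (λ z → suc ρ + suc e ∷ suc e ∷ z) (trans (cong (replicate k 1 ++_) (sym (replicate-+ ρ e 1))) (sym (replicate-+ k (ρ + e) 1))) ⟩
      suc ρ + suc e ∷ suc e ∷ replicate (k + (ρ + e)) 1 ∎

-- Two even lengths: one block inside the other

module BothEven (g r k : ℕ) where
  h a : ℕ
  h = r + suc g
  a = suc (h * 2) + k

  x y : ℕ
  x = suc g * 2
  y = suc h * 2

  -- One of four starts for the parities of `b` and `c`, the others being `evenBase₀`, `evenBase₁`
  -- and `base₁₁`. The block for `y` straddles the edge of length `x`: `r + 1` pairs in the ascent,
  -- `g + 1` in the descent.
  base₁₀ : Even (suc h) 0 (2 + a) (x ∷ replicate a 1) 0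
  base₁₀ = subst (λ a → Even (suc h) 0 (2 + a) (x ∷ replicate a 1) 0) (lem g r k) (record
    { m = suc k
    ; isPath = hook-Path k′ (suc (g * 2))
    ; hd = head
    ; size = lem′ g r k
    ; block = Pairs-++ (suc r) (suc g)
        (Pairs-intro (suc r) (λ t _ le → Adj-++ʳ _ (Adj-asc 0 (suc k′) t z≤n (≤+0 (≤-trans le (≤-reflexive eq))))))
        (subst (λ z → Pairs (hook k′ (suc (g * 2))) z (suc g)) (sym eq)
          (Pairs-intro (suc g) (λ t le le′ → Adj-++ˡ (asc 0 (suc k′)) (Adj-desc (suc k′) x t le le′)))) })
    where
    k′ : ℕ
    k′ = suc r * 2 + k
    eq : suc r * 2 + suc k ≡ suc k′
    eq = +-suc (suc r * 2) k
    lem : ∀ g r k → suc (g * 2) + (suc r * 2 + k) ≡ suc ((r + suc g) * 2) + k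
    lem = solve-∀
    lem′ : ∀ g r k → 2 + (suc (g * 2) + (suc r * 2 + k)) ≡ suc (r + suc g) * 2 + suc k
    lem′ = solve-∀

  base₁₁ : Even (suc h) 0 (2 + a) (x ∷ replicate a 1) 1
  base₁₁ = record
    { m = 2 + k
    ; isPath = castPath (lem₁ g r k) (Path-resp (↭-reflexive (cong₂ (λ u v → u ∷ x ∷ replicate v 1) (lem₂ g r) (lem₃ g r k)))
        (zigzag-Path (suc k) ρ e))
    ; hd = head
    ; size = lem₄ g r k
    ; block = subst (Pairs (zigzag (suc k) ρ e) (2 + k)) (+-comm (suc g) (suc r)) (Pairs-++ (suc g) (suc r)
        (Pairs-intro (suc g) (λ t le le′ → Adj-++ˡ (asc 0 (2 + k)) (Adj-++ˡ (desc (suc e + (2 + k)) (suc ρ)) (Adj-asc (2 + k) x t le le′))))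
        (Pairs-intro (suc r) (λ t le le′ → Adj-++ˡ (asc 0 (2 + k)) (Adj-++ʳ (asc (2 + k) (suc e)) (Adj-desc (suc e + (2 + k)) (suc ρ) t le le′))))) }
    where
    ρ e : ℕ
    ρ = suc (r * 2)
    e = suc (g * 2)
    lem₁ : ∀ g r k → suc (suc k + (suc g * 2 + suc r * 2)) ≡ 1 + (2 + (suc ((r + suc g) * 2) + k))
    lem₁ = solve-∀
    lem₂ : ∀ g r → suc r * 2 + suc g * 2 ≡ suc (r + suc g) * 2
    lem₂ = solve-∀
    lem₃ : ∀ g r k → suc k + (suc (r * 2) + suc (g * 2)) ≡ suc ((r + suc g) * 2) + k
    lem₃ = solve-∀
    lem₄ : ∀ g r k → 1 + (2 + (suc ((r + suc g) * 2) + k)) ≡ suc (r + suc g) * 2 + (2 + k)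
    lem₄ = solve-∀

  -- Growth by the longer length comes first, since its final block contains one for the shorter.
  finish : ∀ {n c} b₀ j → Even (suc h) 0 n (replicate b₀ x ++ replicate a 1) c → Lin (L3 a (j * 2 + b₀) c x y)
  finish {n} {c} b₀ j E = growLin j (subEven (suc r) g (Even.isPath E) (Even.hd E) (Even.size E) (Even.block E)) (begin
    (replicate c y ++ replicate b₀ x ++ replicate a 1) ++ replicate (j * 2 + 0) x
      ≡⟨ cong (λ z → (replicate c y ++ replicate b₀ x ++ replicate a 1) ++ replicate z x) (+-identityʳ (j * 2)) ⟩
    (replicate c y ++ replicate b₀ x ++ replicate a 1) ++ replicate (j * 2) x
      ↭⟨ ++-Solver.solve 4 (λ p q r s → (p ⊕ q ⊕ r) ⊕ s ⊜ r ⊕ (s ⊕ q) ⊕ p) ↭-refl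
          (replicate c y) (replicate b₀ x) (replicate a 1) (replicate (j * 2) x) ⟩
    replicate a 1 ++ (replicate (j * 2) x ++ replicate b₀ x) ++ replicate c y
      ≡⟨ cong (λ z → replicate a 1 ++ z ++ replicate c y) (sym (replicate-+ (j * 2) b₀ x)) ⟩
    L3 a (j * 2 + b₀) c x y ∎)
    where open PermutationReasoning

  lin : ∀ b c → Lin (L3 a b c x y)
  lin b c with evenOrOdd b | evenOrOdd c
  ... | double i   | double j   = castL3 a x y (+-identityʳ (i * 2)) (+-identityʳ (j * 2)) (finish 0 i (evenGrow j (evenBase₀ h k)))
  ... | double i   | double+1 j = castL3 a x y (+-identityʳ (i * 2)) (+-comm (j * 2) 1) (finish 0 i (evenGrow j (evenBase₁ h k)))
  ... | double+1 i | double j   = castL3 a x y (+-comm (i * 2) 1) (+-identityʳ (j * 2)) (finish 1 i (evenGrow j base₁₀))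
  ... | double+1 i | double+1 j = castL3 a x y (+-comm (i * 2) 1) (+-comm (j * 2) 1) (finish 1 i (evenGrow j base₁₁))

castLin : ∀ {L L′} → L ≡ L′ → Lin L → Lin L′
castLin refl l = l

-- Linked to a path with head `x - 2`, the head 1 yields an edge of length `x = 2 g + 2`.
wrapFrom : ∀ g n → From 1 (replicate (suc (g * 2)) 1 ++ replicate (suc (n * 2)) (suc g * 2))
wrapFrom g n = castCount 1 (suc (g * 2)) (suc g * 2) (+-comm (n * 2) 1)
  (evenFrom (evenGrow n E))
  where
  k : ℕ
  k = suc (g * 2)
  E : Even (suc g) 1 (suc g * 2) (replicate k 1) 1
  E = record
    { m = 1
    ; isPath = Path-resp (↭-reflexive (cong₂ (λ u v → u ∷ replicate v 1) (+-comm k 1) (+-identityʳ k)))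
        (castPath (cong suc (+-comm k 1)) (wrap-Path 0 k))
    ; hd = head
    ; size = +-comm 1 (suc k)
    ; block = Pairs-intro (suc g) (λ t le le′ → Adj-++ʳ (asc 0 1) (Adj-asc 1 (suc k) t le le′)) }

-- An even and a larger odd length

-- Because `j < g`, `startPlain` with head `x - 2` reaches the residue `2 j + 1` for `y - 1` ones.
-- The linking edge takes one `x` and leaves an odd number of them to `wrapFrom`.
shifted : ∀ {g h} n q i j → suc j + i ≡ suc h → g ≤ h → j < g → let y = suc (suc h * 2) in
  Lin (L3 (suc (g * 2) + suc h * 2 + 0) (suc n * 2) (suc j * 2 + (2 + (h * 2 + (q * y + 0)))) (suc g * 2) y)
shifted {suc g} {h} n q i j eq g<h (s≤s j≤g) = link3 {a₁ = suc (suc g * 2)} {a₂ = suc h * 2} (suc (n * 2)) _ (suc (suc g) * 2) _ (wrapFrom (suc g) n)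
  (castCount (suc g * 2) (suc h * 2) (suc (suc h * 2)) (lem j h q)
    (startPlain g (h ∸ g) h (suc q) j (g ∸ j)
      (trans (+-suc g _) (cong suc (m+[n∸m]≡n (≤-trans (n≤1+n g) g<h)))) (m+[n∸m]≡n j≤g)))
  refl (lem′ g h)
  where
  lem : ∀ j h q → j * 2 + (suc q * suc (suc h * 2) + 1) ≡ suc j * 2 + (2 + (h * 2 + (q * suc (suc h * 2) + 0)))
  lem = solve-∀
  lem′ : ∀ g h → suc (suc g * 2) + suc h * 2 ≡ suc (suc g * 2) + suc h * 2 + 0
  lem′ = solve-∀

-- The turned path costs `y` and the crest only `x - 2`. The crest brings one edge of length `x`,
-- which suits an odd multiplicity.
crested : ∀ g h n q i j → suc j + i ≡ suc h → let y = suc (suc h * 2); c = suc j * 2 + (2 + (h * 2 + (q * y + 0))) in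
  Lin (L3 (suc (g * 2) + suc h * 2 + 0) (suc (n * 2)) c (suc g * 2) y)
crested g h n q i j eq = go (fanTop F)
  where
  x y c a : ℕ
  x = suc g * 2
  y = suc (suc h * 2)
  c = suc j * 2 + (2 + (h * 2 + (q * y + 0)))
  a = suc h * 2 + 0
  F : Fan y 0 (2 + a) (replicate (suc a) 1) i (suc j + 0) c
  F = turnedFan h 0 q i (suc j) eq
  lem : ∀ g h → g * 2 + suc (suc h * 2 + 0) ≡ suc (g * 2) + suc h * 2 + 0
  lem = solve-∀
  go : (∃ λ t → c + (2 + a) ≡ 2 + t × Adj t (Fan.p F)) → Lin (L3 (suc (g * 2) + suc h * 2 + 0) (suc (n * 2)) c x y)
  go (t , e , adj) = growLin n (proj₂ (crestEven g (Fan.isPath F) e adj)) (begin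
    (replicate (g * 2) 1 ++ replicate c y ++ replicate (suc a) 1) ++ replicate (n * 2 + 1) x
      ↭⟨ ++-Solver.solve 4 (λ p q r s → (p ⊕ q ⊕ r) ⊕ s ⊜ (p ⊕ r) ⊕ s ⊕ q) ↭-refl
          (replicate (g * 2) 1) (replicate c y) (replicate (suc a) 1) (replicate (n * 2 + 1) x) ⟩
    (replicate (g * 2) 1 ++ replicate (suc a) 1) ++ replicate (n * 2 + 1) x ++ replicate c y
      ≡⟨ cong₂ (λ u v → u ++ replicate v x ++ replicate c y)
          (trans (sym (replicate-+ (g * 2) (suc a) 1)) (cong (λ z → replicate z 1) (lem g h))) (+-comm (n * 2) 1) ⟩
    L3 (suc (g * 2) + suc h * 2 + 0) (suc (n * 2)) c x y ∎)
    where open PermutationReasoning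

-- After the turn `j + 1` new pairs lie on top, enough for a block of `x = 2 (g + 1)` vertices when
-- `g ≤ j`; the remaining ones merely lengthen the initial ascent.
nested : ∀ g h n q i j → suc j + i ≡ suc h → g ≤ j → let y = suc (suc h * 2); c = suc j * 2 + (2 + (h * 2 + (q * y + 0))) in
  Lin (L3 (suc (g * 2) + suc h * 2 + 0) (suc n * 2) c (suc g * 2) y)
nested g h n q i j eq g≤j = growLin (suc n) (subEven (j ∸ g) g (Fan.isPath F) (Fan.hd F) (Fan.sizeN F) (Fan.top F)) (begin
  (replicate c y ++ replicate (suc a) 1) ++ replicate (suc n * 2 + 0) x
    ↭⟨ ++-Solver.solve 3 (λ q r s → (q ⊕ r) ⊕ s ⊜ r ⊕ s ⊕ q) ↭-refl
        (replicate c y) (replicate (suc a) 1) (replicate (suc n * 2 + 0) x) ⟩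
  L3 (suc a) (suc n * 2 + 0) c x y
    ≡⟨ cong₂ (λ u v → L3 u v c x y) (lem g h) (+-identityʳ (suc n * 2)) ⟩
  L3 (suc (g * 2) + suc h * 2 + 0) (suc n * 2) c x y ∎)
  where
  open PermutationReasoning
  x y c a : ℕ
  x = suc g * 2
  y = suc (suc h * 2)
  c = suc j * 2 + (2 + (h * 2 + (q * y + 0)))
  a = suc h * 2 + g * 2
  lem : ∀ g h → suc (suc h * 2 + g * 2) ≡ suc (g * 2) + suc h * 2 + 0
  lem = solve-∀
  F : Fan y 0 (2 + a) (replicate (suc a) 1) i (j ∸ g + suc g) c
  F = subst (λ l → Fan y 0 (2 + a) (replicate (suc a) 1) i l c)
        (trans (+-identityʳ (suc j)) (trans (cong suc (sym (m∸n+n≡m g≤j))) (sym (+-suc (j ∸ g) g))))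
        (turnedFan h (g * 2) q i (suc j) eq)

-- Gluing is one edge too dear here. The parity of `b` and, for even positive `b`, the size of the
-- residue of `c` select the construction that saves it.
evenOddExact : ∀ g h b q i j → suc j + i ≡ suc h → g ≤ h → let y = suc (suc h * 2); c = suc j * 2 + (2 + (h * 2 + (q * y + 0))) in
  Lin (L3 (suc (g * 2) + suc h * 2 + 0) b c (suc g * 2) y)
evenOddExact g h b q i j eq g≤h with evenOrOdd b
... | double+1 n = crested g h n q i j eq
... | double zero = castLin (cong (λ z → replicate z 1 ++ replicate (suc j * 2 + (2 + (h * 2 + (q * suc (suc h * 2) + 0)))) (suc (suc h * 2))) (lem g h))
      (From⇒Lin (fanFrom (turnedFan h (g * 2) q i (suc j) eq)))
  where
  lem : ∀ g h → suc (suc h * 2 + g * 2) ≡ suc (g * 2) + suc h * 2 + 0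
  lem = solve-∀
... | double (suc n) with g ≤? j
... | yes g≤j = nested g h n q i j eq g≤j
... | no g≰j = shifted n q i j eq g≤h (≰⇒> g≰j)

evenOdd : ∀ g h k b c → g ≤ h → Lin (L3 (suc (g * 2) + suc h * 2 + k) b c (suc g * 2) (suc (suc h * 2)))
evenOdd g h k b c g≤h with count h c
... | tight F = glue3 b c (suc g * 2) (suc (suc h * 2)) (stdEven g 0 b) (F k) (lem g h k)
  where
  lem : ∀ g h k → suc (g * 2) + 0 + (suc h * 2 + k) ≡ suc (g * 2) + suc h * 2 + k
  lem = solve-∀
evenOdd g h (suc k) b c g≤h | bad q i j eq e =
  castL3 (suc (g * 2) + suc h * 2 + suc k) (suc g * 2) (suc (suc h * 2)) {b} refl (sym e)
    (glue3 b _ (suc g * 2) (suc (suc h * 2)) (stdEven g 0 b) (fanFrom (turnedFan h k q i (suc j) eq)) (lem g h k))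
  where
  lem : ∀ g h k → suc (g * 2) + 0 + suc (suc h * 2 + k) ≡ suc (g * 2) + suc h * 2 + suc k
  lem = solve-∀
evenOdd g h zero b c g≤h | bad q i j eq e =
  castL3 (suc (g * 2) + suc h * 2 + 0) (suc g * 2) (suc (suc h * 2)) {b} refl (sym e) (evenOddExact g h b q i j eq g≤h)

oddEven₃ : ∀ h k b c → Lin (L3 (2 + (suc (h * 2) + k)) b c 3 (suc h * 2))
oddEven₃ h k b c = glue3 b c 3 (suc h * 2) (threeFrom b) (stdEven h k c) refl

oddEven : ∀ g h k b c → Lin (L3 (suc (suc g * 2) + suc (h * 2) + k) b c (suc (suc g * 2)) (suc h * 2))
oddEven g h k b c = glue3 b c _ (suc h * 2) (stdOdd g 0 b) (stdEven h k c) (lem g h k)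
  where
  lem : ∀ g h k → suc (suc g * 2 + 0) + (suc (h * 2) + k) ≡ suc (suc g * 2) + suc (h * 2) + k
  lem = solve-∀

crestLin : ∀ e {n L p t M} → Path n L p → n ≡ 2 + t → Adj t p → 2 + e ∷ replicate e 1 ++ L ↭ M → Lin M
crestLin e π eq a r = _ , _ , Path-resp r (proj₁ (proj₂ (crest e π eq a)))

-- The price is `y - 1` for the shared path, 1 for the turn and 1 for the crest that brings the last
-- edge of length 3: `y + 1` in all.
threeCrest : ∀ l q i j b → suc j + i ≡ 2 + l → let y = suc ((2 + l) * 2); c = suc j * 2 + (2 + (suc l * 2 + (q * y + 0))) in
  Lin (L3 (suc y) (suc b) c 3 y)
threeCrest l q i j b eq = go (fanTop F)
  where
  y c : ℕ
  y = suc ((2 + l) * 2)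
  c = suc j * 2 + (2 + (suc l * 2 + (q * y + 0)))
  O = proj₂ (threeOdd l b)
  B : List ℕ
  B = (replicate b 3 ++ 1 ∷ 1 ∷ []) ++ replicate (2 + l * 2) 1
  F : Fan y (proj₁ (threeOdd l b)) (suc (y + b)) (1 ∷ B) i (suc j + 0) c
  F = turnOdd (suc l) q i (suc j) eq O
  go : (∃ λ t → c + suc (y + b) ≡ 2 + t × Adj t (Fan.p F)) → Lin (L3 (suc y) (suc b) c 3 y)
  go (t , e , adj) = crestLin 1 (Fan.isPath F) e adj
    (++-Solver.solve 5 (λ t o p q r → t ⊕ o ⊕ q ⊕ o ⊕ ((p ⊕ o ⊕ o) ⊕ r) ⊜ (o ⊕ o ⊕ o ⊕ o ⊕ r) ⊕ (t ⊕ p) ⊕ q) ↭-refl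
      (3 ∷ []) (1 ∷ []) (replicate b 3) (replicate c y) (replicate (2 + l * 2) 1))

bothOdd₃ : ∀ h k b c → let y = suc (suc (suc h) * 2) in Lin (L3 (suc y + k) b c 3 y)
bothOdd₃ h k b c with count (suc h) c
... | tight F = glue3 b c 3 (suc (suc (suc h) * 2)) (threeFrom b) (F k) refl
bothOdd₃ h (suc k) b c | bad q i j eq e =
  castL3 (suc (suc (suc (suc h) * 2)) + suc k) 3 (suc (suc (suc h) * 2)) {b} refl (sym e)
    (glue3 b _ 3 (suc (suc (suc h) * 2)) (threeFrom b) (fanFrom (turnedFan (suc h) k q i (suc j) eq)) (lem h k))
  where
  lem : ∀ h k → 2 + suc (suc (suc h) * 2 + k) ≡ suc (suc (suc (suc h) * 2)) + suc k
  lem = solve-∀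
bothOdd₃ h zero zero c | bad q i j eq e =
  castL3 (suc (suc (suc (suc h) * 2)) + 0) 3 (suc (suc (suc h) * 2)) {0} refl (sym e)
    (castLin (cong (λ z → L3 z 0 (suc j * 2 + (2 + (suc h * 2 + (q * suc (suc (suc h) * 2) + 0)))) 3 (suc (suc (suc h) * 2))) (lem h))
      (From⇒Lin (fanFrom (turnedFan (suc h) 1 q i (suc j) eq))))
  where
  lem : ∀ h → suc (suc (suc h) * 2 + 1) ≡ suc (suc (suc (suc h) * 2)) + 0
  lem = solve-∀
bothOdd₃ h zero (suc b) c | bad q i j eq e =
  castL3 (suc (suc (suc (suc h) * 2)) + 0) 3 (suc (suc (suc h) * 2)) {suc b} refl (sym e)
    (castLin (cong (λ z → L3 z (suc b) (suc j * 2 + (2 + (suc h * 2 + (q * suc (suc (suc h) * 2) + 0)))) 3 (suc (suc (suc h) * 2)))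
        (sym (+-identityʳ (suc (suc (suc (suc h) * 2))))))
      (threeCrest h q i j b eq))

-- Two odd lengths greater than 3

-- Linking the heads 0 and `x - 1` uses up one edge of length `x`, and the residue of the rest is
-- even, hence tight. That saves the edge needed when `j` is so large that the path for `y` must be
-- turned.
linkedOdd : ∀ {g h} k q i j q′ i′ j′ → suc g ≤ h → suc j + i ≡ suc h → suc j′ + i′ ≡ 2 + g →
  let x = suc ((2 + g) * 2); y = suc (suc h * 2) in
  Lin (L3 (x + suc h * 2 + k) (suc (suc (j′ * 2 + (2 + (suc g * 2 + (q′ * x + 0))))))
    (suc j * 2 + (2 + (h * 2 + (q * y + 0)))) x y)
linkedOdd {g} {h} k q i j q′ i′ j′ g<h eq eq′ with j ≤? suc g
-- Without a turn one edge of length 1 is left over; it goes into the path for `x`, hence `suc k`.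
... | yes j≤g = link3 {a₁ = (2 + g) * 2 + suc k} {a₂ = suc h * 2} (suc (j′ * 2 + (2 + (suc g * 2 + (q′ * x + 0))))) _ x y
      (castCount 0 ((2 + g) * 2 + suc k) x (lem₁ g q′ j′) (stdGood (suc g) (suc k) (suc q′) (suc i′) j′ (trans (+-suc j′ i′) eq′)))
      (castCount ((2 + g) * 2) (suc h * 2) y (lem₂ h q j)
        (startPlain (suc g) (h ∸ suc g) h (suc q) j (suc g ∸ j) (trans (+-suc (suc g) _) (cong suc (m+[n∸m]≡n g<h))) (m+[n∸m]≡n j≤g)))
      refl (lem₃ g h k)
  where
  x y : ℕ
  x = suc ((2 + g) * 2)
  y = suc (suc h * 2)
  lem₁ : ∀ g q j → j * 2 + (suc q * suc ((2 + g) * 2) + 0) ≡ suc (j * 2 + (2 + (suc g * 2 + (q * suc ((2 + g) * 2) + 0))))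
  lem₁ = solve-∀
  lem₂ : ∀ h q j → j * 2 + (suc q * suc (suc h * 2) + 1) ≡ suc j * 2 + (2 + (h * 2 + (q * suc (suc h * 2) + 0)))
  lem₂ = solve-∀
  lem₃ : ∀ g h k → (2 + g) * 2 + suc k + suc h * 2 ≡ suc ((2 + g) * 2) + suc h * 2 + k
  lem₃ = solve-∀
... | no j≰g = link3 {a₁ = (2 + g) * 2 + k} {a₂ = suc (suc h * 2)} (suc (j′ * 2 + (2 + (suc g * 2 + (q′ * x + 0))))) _ x y
      (castCount 0 ((2 + g) * 2 + k) x (lem₁ g q′ j′) (stdGood (suc g) k (suc q′) (suc i′) j′ (trans (+-suc j′ i′) eq′)))
      (castCount ((2 + g) * 2) (suc (suc h * 2)) y
        (trans (lem₂ g h q (j ∸ suc g)) (cong (λ z → suc z * 2 + (2 + (h * 2 + (q * y + 0)))) (m∸n+n≡m (≤-trans (n≤1+n _) (≰⇒> j≰g)))))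
        (startTurned g (h ∸ suc g) h (suc q) (j ∸ suc g) (suc h ∸ (j ∸ suc g)) (trans (+-suc (suc g) _) (cong suc (m+[n∸m]≡n g<h)))
          (m+[n∸m]≡n (≤-trans (m∸n≤m j (suc g)) (≤-trans (≤-trans (n≤1+n j) (m≤m+n (suc j) i)) (≤-reflexive eq))))))
      refl (lem₃ g h k)
  where
  x y : ℕ
  x = suc ((2 + g) * 2)
  y = suc (suc h * 2)
  lem₁ : ∀ g q j → j * 2 + (suc q * suc ((2 + g) * 2) + 0) ≡ suc (j * 2 + (2 + (suc g * 2 + (q * suc ((2 + g) * 2) + 0))))
  lem₁ = solve-∀
  lem₂ : ∀ g h q a → a * 2 + (2 + (g * 2 + (suc q * suc (suc h * 2) + 1))) ≡ suc (a + suc g) * 2 + (2 + (h * 2 + (q * suc (suc h * 2) + 0)))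
  lem₂ = solve-∀
  lem₃ : ∀ g h k → (2 + g) * 2 + k + suc (suc h * 2) ≡ suc ((2 + g) * 2) + suc h * 2 + k
  lem₃ = solve-∀

bothOdd : ∀ g h k b c → suc g ≤ h → let x = suc ((2 + g) * 2); y = suc (suc h * 2) in
  Lin (L3 (x + suc h * 2 + k) b c x y)
bothOdd g h k b c g<h with count h c | count (suc g) b
... | tight F | _ = glue3 b c (suc ((2 + g) * 2)) (suc (suc h * 2)) (stdOdd (suc g) 0 b) (F k) (lem g h k)
  where
  lem : ∀ g h k → suc ((2 + g) * 2 + 0) + (suc h * 2 + k) ≡ suc ((2 + g) * 2) + suc h * 2 + k
  lem = solve-∀
... | bad q i j eq e | tight F =
  castL3 (suc ((2 + g) * 2) + suc h * 2 + k) (suc ((2 + g) * 2)) (suc (suc h * 2)) {b} refl (sym e)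
    (glue3 b _ (suc ((2 + g) * 2)) (suc (suc h * 2)) (F 0) (fanFrom (turnedFan h k q i (suc j) eq)) (lem g h k))
  where
  lem : ∀ g h k → (2 + g) * 2 + 0 + suc (suc h * 2 + k) ≡ suc ((2 + g) * 2) + suc h * 2 + k
  lem = solve-∀
... | bad q i j eq e | bad q′ i′ j′ eq′ e′ =
  castL3 (suc ((2 + g) * 2) + suc h * 2 + k) (suc ((2 + g) * 2)) (suc (suc h * 2)) (sym e′) (sym e)
    (linkedOdd k q i j q′ i′ j′ g<h eq eq′)

-- Matching the constructions with `f`

even-double : ∀ k → even (k * 2) ≡ true
even-double k = cong (_≡ᵇ 0) (m*n%n≡0 k 2)

even-double+1 : ∀ k → even (suc (k * 2)) ≡ false
even-double+1 k = cong (_≡ᵇ 0) ([m+kn]%n≡m%n 1 k 2)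

f-even-even : ∀ g h → f (g * 2) (h * 2) ≡ h * 2 ∸ 1
f-even-even g h rewrite even-double g | even-double h = refl

f-even-odd : ∀ g h → f (g * 2) (suc (h * 2)) ≡ g * 2 + suc (h * 2) ∸ 2
f-even-odd g h rewrite even-double g | even-double+1 h | ∨-zeroʳ (g * 2 ≡ᵇ 3) = refl

f-odd : ∀ g s → let p = suc ((2 + g) * 2) in f p s ≡ p + s ∸ 1
f-odd g s rewrite even-double+1 (2 + g) = refl

stdAny : ∀ s k c → From 0 (replicate (suc s + k) 1 ++ replicate c (suc s))
stdAny s k c with evenOrOdd s
... | double+1 g = subst (λ z → From 0 (replicate z 1 ++ replicate c (suc g * 2))) (+-suc (suc (g * 2)) k) (stdEven g (suc k) c)
... | double zero = subst (From 0) (replicate-+ (suc k) c 1) (from (asc-Path (suc k + c)) head)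
... | double (suc g) = stdOdd g k c

-- Equal lengths, and below the length 1, do arise: when `c = 0`, `y` may be `v - 1` or `v - x`, and
-- then the two dotted lengths coincide or one of them is 1.
diagonal : ∀ a b c s → From 0 (replicate a 1 ++ replicate (b + c) s) → Lin (L3 a b c s s)
diagonal a b c s F = castLin (cong (replicate a 1 ++_) (replicate-+ b c s)) (From⇒Lin F)

shortFirst : ∀ a b c s k → suc s + k ≡ a → Lin (L3 a b c 1 (suc s))
shortFirst a b c s k refl = castLin eq (From⇒Lin (stdAny s (k + b) c))
  where
  eq : replicate (suc s + (k + b)) 1 ++ replicate c (suc s) ≡ L3 (suc s + k) b c 1 (suc s)
  eq = trans (cong (_++ replicate c (suc s)) (trans (cong (λ z → replicate z 1) (sym (+-assoc (suc s) k b))) (replicate-+ (suc s + k) b 1)))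
    (++-assoc (replicate (suc s + k) 1) (replicate b 1) (replicate c (suc s)))

castOnes : ∀ {a a′} b c x y → a ≡ a′ → Lin (L3 a b c x y) → Lin (L3 a′ b c x y)
castOnes b c x y refl l = l

evenEvenCase : ∀ g h k b c → g ≤ h → Lin (L3 (suc (h * 2) + k) b c (suc g * 2) (suc h * 2))
evenEvenCase g h k b c g≤h with m≤n⇒m<n∨m≡n g≤h
... | inj₂ refl = diagonal (suc (h * 2) + k) b c (suc h * 2) (stdEven h k (b + c))
... | inj₁ g<h = subst (λ h → Lin (L3 (suc (h * 2) + k) b c (suc g * 2) (suc h * 2))) (m∸n+n≡m g<h) (BothEven.lin g (h ∸ suc g) k b c)

oddOddCase : ∀ g h k b c → g ≤ h → let p = suc (suc g * 2); s = suc (suc h * 2) in Lin (L3 (f p s + k) b c p s)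
oddOddCase zero zero k b c _ = diagonal (4 + k) b c 3 (stdOdd 0 (suc k) (b + c))
oddOddCase zero (suc h) k b c _ = bothOdd₃ h k b c
oddOddCase (suc g) h k b c g<h = castOnes b c (suc ((2 + g) * 2)) (suc (suc h * 2))
  (trans (lem g h k) (cong (_+ k) (sym (f-odd g (suc (suc h * 2)))))) (bothOdd g h k b c g<h)
  where
  lem : ∀ g h k → suc ((2 + g) * 2) + suc h * 2 + k ≡ (2 + g) * 2 + suc (suc h * 2) + k
  lem = solve-∀

half : ∀ {g h} → g * 2 ≤ suc (h * 2) → g ≤ h
half {g} {h} le = ≤-pred (*-cancelʳ-< 2 g (suc h) (s≤s le))

core+ : ∀ p s k b c → 1 ≤ p → p ≤ s → Lin (L3 (f p s + k) b c p s)
core+ p s k b c 1≤p p≤s with evenOrOdd p | evenOrOdd s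
core+ _ _ k b c () p≤s | double zero | _
core+ _ _ k b c 1≤p () | double (suc g) | double zero
core+ _ _ k b c 1≤p p≤s | double (suc g) | double (suc h) =
  castOnes b c (suc g * 2) (suc h * 2) (cong (_+ k) (sym (f-even-even (suc g) (suc h))))
    (evenEvenCase g h k b c (half-≤ g h (≤-pred (≤-pred p≤s))))
core+ _ _ k b c 1≤p (s≤s ()) | double (suc g) | double+1 zero
core+ _ _ k b c 1≤p p≤s | double (suc g) | double+1 (suc h) =
  castOnes b c (suc g * 2) (suc (suc h * 2)) (trans (lem g h k) (cong (_+ k) (sym (f-even-odd (suc g) (suc h)))))
    (evenOdd g h k b c (half (≤-pred (≤-pred p≤s))))
  where
  lem : ∀ g h k → suc (g * 2) + suc h * 2 + k ≡ g * 2 + suc (suc h * 2) + k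
  lem = solve-∀
core+ _ _ k b c 1≤p () | double+1 g | double zero
core+ _ _ k b c 1≤p p≤s | double+1 zero | double (suc h) = shortFirst _ b c (suc (h * 2)) k refl
core+ _ _ k b c 1≤p p≤s | double+1 zero | double+1 h = shortFirst _ b c (h * 2) k refl
core+ _ _ k b c 1≤p p≤s | double+1 (suc zero) | double (suc h) = oddEven₃ h k b c
core+ _ _ k b c 1≤p p≤s | double+1 (suc (suc g)) | double (suc h) =
  castOnes b c (suc ((2 + g) * 2)) (suc h * 2) (trans (lem g h k) (cong (_+ k) (sym (f-odd g (suc h * 2)))))
    (oddEven (suc g) h k b c)
  where
  lem : ∀ g h k → suc ((2 + g) * 2) + suc (h * 2) + k ≡ (2 + g) * 2 + suc h * 2 + k
  lem = solve-∀
core+ _ _ k b c 1≤p (s≤s ()) | double+1 (suc g) | double+1 zero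
core+ _ _ k b c 1≤p p≤s | double+1 (suc g) | double+1 (suc h) =
  oddOddCase g h k b c (half-≤ g h (≤-pred (≤-pred (≤-pred p≤s))))

core : ∀ p s a b c → 1 ≤ p → p ≤ s → f p s ≤ a → Lin (L3 a b c p s)
core p s a b c 1≤p p≤s le = castOnes b c p s (m+[n∸m]≡n le) (core+ p s (a ∸ f p s) b c 1≤p p≤s)

-- Multiplication by units

length-gaps : ∀ p → length (gaps p) ≡ pred (length p)
length-gaps [] = refl
length-gaps (u ∷ []) = refl
length-gaps (u ∷ w ∷ p) = cong suc (length-gaps (w ∷ p))

Path-length : ∀ {n L p} → Path (suc n) L p → n ≡ length L
Path-length {n} {L} {p} π = begin
  n                              ≡⟨ cong pred (sym (length-asc 0 (suc n))) ⟩
  pred (length (asc 0 (suc n)))  ≡⟨ cong pred (sym (↭-length (cover π))) ⟩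
  pred (length p)                ≡⟨ sym (length-gaps p) ⟩
  length (gaps p)                ≡⟨ ↭-length (steps π) ⟩
  length L ∎
  where open ≡-Reasoning

module Modular (n : ℕ) where
  v : ℕ
  v = suc n

  %-*ʳ : ∀ a b → (a * (b % v)) % v ≡ (a * b) % v
  %-*ʳ a b = begin
    (a * (b % v)) % v              ≡⟨ %-distribˡ-* a (b % v) v ⟩
    ((a % v) * (b % v % v)) % v    ≡⟨ cong (λ z → ((a % v) * z) % v) (m%n%n≡m%n b v) ⟩
    ((a % v) * (b % v)) % v        ≡⟨ sym (%-distribˡ-* a b v) ⟩
    (a * b) % v ∎
    where open ≡-Reasoning

  unit-cancel : ∀ k k′ → (k * k′) % v ≡ 1 % v → ∀ z → (k * (k′ * z)) % v ≡ z % v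
  unit-cancel k k′ e z = begin
    (k * (k′ * z)) % v      ≡⟨ cong (_% v) (trans (sym (*-assoc k k′ z)) (*-comm (k * k′) z)) ⟩
    (z * (k * k′)) % v      ≡⟨ sym (%-*ʳ z (k * k′)) ⟩
    (z * (k * k′ % v)) % v  ≡⟨ cong (λ w → (z * w) % v) e ⟩
    (z * (1 % v)) % v       ≡⟨ %-*ʳ z 1 ⟩
    (z * 1) % v             ≡⟨ cong (_% v) (*-identityʳ z) ⟩
    z % v ∎
    where open ≡-Reasoning

  edgeLen-sym : ∀ a b → edgeLen v a b ≡ edgeLen v b a
  edgeLen-sym a b = cong (λ z → z ⊓ (v ∸ z)) (∣-∣-comm a b)

  -- The two residues differ by `d % v`, or by `v - d % v` after a wrap-around, and the minimum in
  -- an edge length does not tell these apart.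
  edgeLen-+ : ∀ a d → edgeLen v (a % v) ((a + d) % v) ≡ hat v d
  edgeLen-+ a d with a % v + d % v <? v
  ... | yes lt = cong (λ z → z ⊓ (v ∸ z)) (begin
    ∣ a % v - (a + d) % v ∣      ≡⟨ cong (∣ a % v -_∣) (trans (%-distribˡ-+ a d v) (m<n⇒m%n≡m lt)) ⟩
    ∣ a % v - a % v + d % v ∣    ≡⟨ ∣m-m+n∣≡n (a % v) (d % v) ⟩
    d % v ∎)
    where open ≡-Reasoning
  ... | no ≮ = trans (cong (λ z → z ⊓ (v ∸ z)) gap)
    (trans (cong ((v ∸ d % v) ⊓_) (m∸[m∸n]≡n (<⇒≤ (m%n<n d v)))) (⊓-comm (v ∸ d % v) (d % v)))
    where
    open ≡-Reasoning
    A D : ℕ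
    A = a % v
    D = d % v
    v≤ : v ≤ A + D
    v≤ = ≮⇒≥ ≮
    e : (a + d) % v ≡ A + D ∸ v
    e = begin
      (a + d) % v                ≡⟨ %-distribˡ-+ a d v ⟩
      (A + D) % v                ≡⟨ cong (_% v) (sym (m∸n+n≡m v≤)) ⟩
      (A + D ∸ v + v) % v        ≡⟨ cong (λ z → (A + D ∸ v + z) % v) (sym (*-identityˡ v)) ⟩
      (A + D ∸ v + 1 * v) % v    ≡⟨ [m+kn]%n≡m%n (A + D ∸ v) 1 v ⟩
      (A + D ∸ v) % v            ≡⟨ m<n⇒m%n≡m (m<n+o⇒m∸n<o (A + D) v (+-mono-< (m%n<n a v) (m%n<n d v))) ⟩
      A + D ∸ v ∎
    split : A ≡ (A + D ∸ v) + (v ∸ D)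
    split = +-cancelʳ-≡ D A _ (begin
      A + D                          ≡⟨ sym (m∸n+n≡m v≤) ⟩
      A + D ∸ v + v                  ≡⟨ cong (A + D ∸ v +_) (sym (m∸n+n≡m (<⇒≤ (m%n<n d v)))) ⟩
      A + D ∸ v + (v ∸ D + D)        ≡⟨ sym (+-assoc (A + D ∸ v) (v ∸ D) D) ⟩
      A + D ∸ v + (v ∸ D) + D ∎)
    gap : ∣ a % v - (a + d) % v ∣ ≡ v ∸ D
    gap = begin
      ∣ A - (a + d) % v ∣                          ≡⟨ cong (∣ A -_∣) e ⟩
      ∣ A - A + D ∸ v ∣                            ≡⟨ cong (λ z → ∣ z - A + D ∸ v ∣) split ⟩
      ∣ (A + D ∸ v) + (v ∸ D) - A + D ∸ v ∣        ≡⟨ trans (∣-∣-comm _ (A + D ∸ v)) (∣m-m+n∣≡n (A + D ∸ v) (v ∸ D)) ⟩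
      v ∸ D ∎

  edgeLen-% : ∀ a b → edgeLen v (a % v) (b % v) ≡ hat v ∣ a - b ∣
  edgeLen-% a b with ≤-total a b
  ... | inj₁ a≤b = trans (cong (λ z → edgeLen v (a % v) (z % v)) (sym (m+[n∸m]≡n a≤b)))
    (trans (edgeLen-+ a (b ∸ a)) (cong (hat v) (sym (m≤n⇒∣m-n∣≡n∸m a≤b))))
  ... | inj₂ b≤a = trans (edgeLen-sym (a % v) (b % v)) (trans (cong (λ z → edgeLen v (b % v) (z % v)) (sym (m+[n∸m]≡n b≤a)))
    (trans (edgeLen-+ b (a ∸ b)) (cong (hat v) (sym (m≤n⇒∣n-m∣≡n∸m b≤a)))))

  scale : ℕ → ℕ → ℕ
  scale k u = (k * u) % v

  scale-edgeLengths : ∀ k p → edgeLengths v (map (scale k) p) ≡ map (λ d → hat v (k * d)) (gaps p)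
  scale-edgeLengths k [] = refl
  scale-edgeLengths k (u ∷ []) = refl
  scale-edgeLengths k (u ∷ w ∷ p) = cong₂ _∷_
    (trans (edgeLen-% (k * u) (k * w)) (cong (hat v) (sym (*-distribˡ-∣-∣ k u w))))
    (scale-edgeLengths k (w ∷ p))

  scale-inverse : ∀ k k′ → (k * k′) % v ≡ 1 % v → ∀ {i} → i < v → scale k (scale k′ i) ≡ i
  scale-inverse k k′ e {i} i<v = trans (%-*ʳ k (k′ * i)) (trans (unit-cancel k k′ e i) (m<n⇒m%n≡m i<v))

  scale-upTo : ∀ k k′ → (k * k′) % v ≡ 1 % v → map (scale k) (upTo v) ↭ upTo v
  scale-upTo k k′ e = ∼bag⇒↭ (unique∧set⇒bag
    (subst Unique (sym (map-upTo (scale k) v)) (applyUpTo⁺₁ (scale k) v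
      (λ {i} {j} i<j j<v eq → <⇒≢ i<j (trans (sym (scale-inverse k′ k e′ (<-trans i<j j<v))) (trans (cong (scale k′) eq) (scale-inverse k′ k e′ j<v))))))
    (upTo⁺ v)
    (mk⇔ to from′))
    where
    e′ : (k′ * k) % v ≡ 1 % v
    e′ = trans (cong (_% v) (*-comm k′ k)) e
    to : ∀ {z} → z ∈ map (scale k) (upTo v) → z ∈ upTo v
    to z∈ with ∈-map⁻ (scale k) z∈
    ... | u , _ , refl = ∈-upTo⁺ (m%n<n (k * u) v)
    from′ : ∀ {z} → z ∈ upTo v → z ∈ map (scale k) (upTo v)
    from′ {z} z∈ = subst (_∈ map (scale k) (upTo v)) (scale-inverse k k′ e (∈-upTo⁻ z∈))
      (∈-map⁺ (scale k) (∈-upTo⁺ (m%n<n (k′ * z) v)))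

  hat-cong : ∀ g g′ → g % v ≡ g′ % v → hat v g ≡ hat v g′
  hat-cong g g′ = cong (λ z → z ⊓ (v ∸ z))

  hat-*-% : ∀ k g → hat v (k * (g % v)) ≡ hat v (k * g)
  hat-*-% k g = hat-cong (k * (g % v)) (k * g) (%-*ʳ k g)

  -- The inner hat may replace `g` by `-g` modulo `v`; the sign passes through the product and the
  -- outer hat ignores it.
  hat-*-hat : ∀ k g → hat v (k * hat v g) ≡ hat v (k * g)
  hat-*-hat k g with ⊓-sel (g % v) (v ∸ g % v)
  ... | inj₁ e = trans (cong (λ z → hat v (k * z)) e) (hat-*-% k g)
  ... | inj₂ e = begin
    hat v (k * hat v g)                          ≡⟨ cong (λ z → hat v (k * z)) e ⟩
    hat v (k * (v ∸ G))                          ≡⟨ cong (hat v) (trans (cong (k *_) (sym (m≤n⇒∣n-m∣≡n∸m (<⇒≤ (m%n<n g v))))) (*-distribˡ-∣-∣ k v G)) ⟩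
    hat v ∣ k * v - k * G ∣                      ≡⟨ sym (edgeLen-% (k * v) (k * G)) ⟩
    edgeLen v ((k * v) % v) ((k * G) % v)        ≡⟨ cong (λ z → edgeLen v z ((k * G) % v)) (m*n%n≡0 k v) ⟩
    hat v (k * G)                                ≡⟨ hat-*-% k g ⟩
    hat v (k * g) ∎
    where
    open ≡-Reasoning
    G : ℕ
    G = g % v

  Admissible : ℕ → Set
  Admissible z = (1 ≤ z) × (z ≤ v / 2) × (gcd v z ≡ 1)

  hat-small : ∀ {z} → Admissible z → hat v z ≡ z
  hat-small {z} (1≤z , z≤v/2 , _) = trans (cong (λ w → w ⊓ (v ∸ w)) (m<n⇒m%n≡m z<v)) (m≤n⇒m⊓n≡m (m+n≤o⇒m≤o∸n z z+z≤v))
    where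
    z+z≤v : z + z ≤ v
    z+z≤v = ≤-trans (≤-reflexive (trans (cong (z +_) (sym (+-identityʳ z))) (*-comm 2 z))) (≤-trans (*-monoˡ-≤ 2 z≤v/2) (m/n*n≤m v 2))
    z<v : z < v
    z<v = ≤-trans (+-monoˡ-≤ z 1≤z) z+z≤v

  -- Stated for the lists and not for `z`, since a length of multiplicity 0 need not be admissible.
  replicate-hat : ∀ m {z} → All Admissible (replicate m z) → replicate m (hat v z) ≡ replicate m z
  replicate-hat zero _ = refl
  replicate-hat (suc m) (a ∷ _) = cong (replicate (suc m)) (hat-small a)

  realize : ∀ k k′ → (k * k′) % v ≡ 1 % v → ∀ {L M} → Lin L → length L ≡ n →
    map (λ d → hat v (k * d)) L ↭ M → Realizable v M
  realize k k′ e {L} (m , p , π) len r with trans (Path-length π) len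
  ... | refl = map (scale k) p
    , ↭-trans (map⁺ (scale k) (↭-trans (cover π) (↭-reflexive (asc-upTo v)))) (scale-upTo k k′ e)
    , ↭-trans (↭-reflexive (scale-edgeLengths k p)) (↭-trans (map⁺ _ (steps π)) r)

-- The three reductions and the theorem

coreUnordered : ∀ P Q a b c → 1 ≤ P → 1 ≤ Q → f (P ⊓ Q) (P ⊔ Q) ≤ a → Lin (L3 a b c P Q)
coreUnordered P Q a b c 1≤P 1≤Q le with ≤-total P Q
... | inj₁ P≤Q = core P Q a b c 1≤P P≤Q (subst₂ (λ p s → f p s ≤ a) (m≤n⇒m⊓n≡m P≤Q) (m≤n⇒m⊔n≡n P≤Q) le)
... | inj₂ Q≤P = Lin-resp (++⁺ˡ (replicate a 1) (++-comm (replicate c Q) (replicate b P)))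
  (core Q P a c b 1≤Q Q≤P (subst₂ (λ p s → f p s ≤ a) (m≥n⇒m⊓n≡n Q≤P) (m≥n⇒m⊔n≡m Q≤P) le))

length-L3 : ∀ a b c x y → length (L3 a b c x y) ≡ a + b + c
length-L3 a b c x y = begin
  length (L3 a b c x y)
    ≡⟨ length-++ (replicate a 1) ⟩
  length (replicate a 1) + length (replicate b x ++ replicate c y)
    ≡⟨ cong₂ _+_ (length-replicate a) (trans (length-++ (replicate b x)) (cong₂ _+_ (length-replicate b) (length-replicate c))) ⟩
  a + (b + c)
    ≡⟨ sym (+-assoc a b c) ⟩
  a + b + c ∎
  where open ≡-Reasoning

module _ (x y a b c xi yi : ℕ) (1<x : 1 < x) (x<y : x < y) where
  private
    n : ℕ
    n = a + b + c

  open Modular n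

  module _ (adm : All Admissible (L3 a b c x y)) (ex : (x * xi) % v ≡ 1 % v) (ey : (y * yi) % v ≡ 1 % v) where

    private
      admA : All Admissible (replicate a 1)
      admA = ++⁻ˡ (replicate a 1) adm
      admB : All Admissible (replicate b x)
      admB = ++⁻ˡ (replicate b x) (++⁻ʳ (replicate a 1) adm)
      admC : All Admissible (replicate c y)
      admC = ++⁻ʳ (replicate b x) (++⁻ʳ (replicate a 1) adm)

    realize₃ : ∀ k k′ → (k * k′) % v ≡ 1 % v → ∀ n₁ n₂ n₃ d₁ d₂ {z₁ z₂ z₃} →
      All Admissible (replicate n₁ z₁) → All Admissible (replicate n₂ z₂) → All Admissible (replicate n₃ z₃) →
      Lin (L3 n₁ n₂ n₃ d₁ d₂) → n₁ + n₂ + n₃ ≡ n →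
      hat v (k * 1) ≡ hat v z₁ → hat v (k * d₁) ≡ hat v z₂ → hat v (k * d₂) ≡ hat v z₃ →
      replicate n₁ z₁ ++ replicate n₂ z₂ ++ replicate n₃ z₃ ↭ L3 a b c x y → Realizable v (L3 a b c x y)
    realize₃ k k′ e n₁ n₂ n₃ d₁ d₂ {z₁} {z₂} {z₃} h₁ h₂ h₃ l len e₁ e₂ e₃ r =
      realize k k′ e l (trans (length-L3 n₁ n₂ n₃ d₁ d₂) len) (↭-trans (↭-reflexive (begin
        map g (L3 n₁ n₂ n₃ d₁ d₂)
          ≡⟨ trans (map-++ g (replicate n₁ 1) _) (cong (map g (replicate n₁ 1) ++_) (map-++ g (replicate n₂ d₁) (replicate n₃ d₂))) ⟩
        map g (replicate n₁ 1) ++ map g (replicate n₂ d₁) ++ map g (replicate n₃ d₂)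
          ≡⟨ cong₂ _++_ (part n₁ 1 h₁ e₁) (cong₂ _++_ (part n₂ d₁ h₂ e₂) (part n₃ d₂ h₃ e₃)) ⟩
        replicate n₁ z₁ ++ replicate n₂ z₂ ++ replicate n₃ z₃ ∎)) r)
      where
      open ≡-Reasoning
      g : ℕ → ℕ
      g d = hat v (k * d)
      part : ∀ m d {z} → All Admissible (replicate m z) → g d ≡ hat v z → map g (replicate m d) ≡ replicate m z
      part m d h e = trans (map-replicate g m d) (trans (cong (replicate m) e) (replicate-hat m h))

    unit-nonzero : ∀ g g′ → 1 ≤ n → (g * g′) % v ≡ 1 % v → 1 ≤ hat v g
    unit-nonzero g g′ 1≤n e = ⊓-glb (n≢0⇒n>0 g≢0) (m<n⇒0<n∸m (m%n<n g v))
      where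
      g≢0 : g % v ≢ 0
      g≢0 z = 0≢1+n (begin
        0                     ≡⟨ sym (cong (_% v) (*-zeroʳ g′)) ⟩
        (g′ * 0) % v          ≡⟨ cong (λ w → (g′ * w) % v) (sym z) ⟩
        (g′ * (g % v)) % v    ≡⟨ %-*ʳ g′ g ⟩
        (g′ * g) % v          ≡⟨ cong (_% v) (*-comm g′ g) ⟩
        (g * g′) % v          ≡⟨ e ⟩
        1 % v                 ≡⟨ m<n⇒m%n≡m (s≤s 1≤n) ⟩
        1 ∎)
        where open ≡-Reasoning

    inverse-sym : ∀ g g′ → (g * g′) % v ≡ 1 % v → (g′ * g) % v ≡ 1 % v
    inverse-sym g g′ e = trans (cong (_% v) (*-comm g′ g)) e

    ratio : ∀ g g′ h h′ → (g * g′) % v ≡ 1 % v → (h * h′) % v ≡ 1 % v → ((g′ * h) * (h′ * g)) % v ≡ 1 % v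
    ratio g g′ h h′ e e′ = begin
      ((g′ * h) * (h′ * g)) % v   ≡⟨ cong (_% v) (lem g g′ h h′) ⟩
      (g * (g′ * (h * h′))) % v   ≡⟨ unit-cancel g g′ e (h * h′) ⟩
      (h * h′) % v                ≡⟨ e′ ⟩
      1 % v ∎
      where
      open ≡-Reasoning
      lem : ∀ g g′ h h′ → (g′ * h) * (h′ * g) ≡ g * (g′ * (h * h′))
      lem = solve-∀

    realizable : 1 ≤ n →
      f x y ≤ a
      ⊎ f (hat v (xi * y) ⊓ hat v xi) (hat v (xi * y) ⊔ hat v xi) ≤ b
      ⊎ f (hat v yi ⊓ hat v (x * yi)) (hat v yi ⊔ hat v (x * yi)) ≤ c →
      Realizable v (L3 a b c x y)
    realizable 1≤n (inj₁ le) = realize₃ 1 1 refl a b c x y admA admB admC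
      (core x y a b c (<⇒≤ 1<x) (<⇒≤ x<y) le) refl
      (cong (hat v) (*-identityˡ 1)) (cong (hat v) (*-identityˡ x)) (cong (hat v) (*-identityˡ y)) ↭-refl
    -- Multiplication by `x` sends the lengths 1, `hat v (xi * y)`, `hat v xi` to `x`, `y`, 1, so
    -- `b` becomes the multiplicity of 1.
    realizable 1≤n (inj₂ (inj₁ le)) = realize₃ x xi ex b c a (hat v (xi * y)) (hat v xi) admB admC admA
      (coreUnordered (hat v (xi * y)) (hat v xi) b c a
        (unit-nonzero (xi * y) (yi * x) 1≤n (ratio x xi y yi ex ey)) (unit-nonzero xi x 1≤n (inverse-sym x xi ex)) le)
      (lem a b c)
      (cong (hat v) (*-identityʳ x))
      (trans (hat-*-hat x (xi * y)) (hat-cong (x * (xi * y)) y (unit-cancel x xi ex y)))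
      (trans (hat-*-hat x xi) (hat-cong (x * xi) 1 ex))
      (++-Solver.solve 3 (λ p q r → q ⊕ r ⊕ p ⊜ p ⊕ q ⊕ r) ↭-refl (replicate a 1) (replicate b x) (replicate c y))
      where
      lem : ∀ a b c → b + c + a ≡ a + b + c
      lem = solve-∀
    realizable 1≤n (inj₂ (inj₂ le)) = realize₃ y yi ey c a b (hat v yi) (hat v (x * yi)) admC admA admB
      (coreUnordered (hat v yi) (hat v (x * yi)) c a b
        (unit-nonzero yi y 1≤n (inverse-sym y yi ey))
        (unit-nonzero (x * yi) (y * xi) 1≤n (ratio′ (ratio x xi y yi ex ey))) le)
      (lem a b c)
      (cong (hat v) (*-identityʳ y))
      (trans (hat-*-hat y yi) (hat-cong (y * yi) 1 ey))
      (trans (hat-*-hat y (x * yi)) (hat-cong (y * (x * yi)) x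
        (trans (cong (λ z → (y * z) % v) (*-comm x yi)) (unit-cancel y yi ey x))))
      (++-Solver.solve 3 (λ p q r → r ⊕ p ⊕ q ⊜ p ⊕ q ⊕ r) ↭-refl (replicate a 1) (replicate b x) (replicate c y))
      where
      lem : ∀ a b c → c + a + b ≡ a + b + c
      lem = solve-∀
      ratio′ : ((xi * y) * (yi * x)) % v ≡ 1 % v → ((x * yi) * (y * xi)) % v ≡ 1 % v
      ratio′ = trans (cong (_% v) (lem′ x xi y yi))
        where
        lem′ : ∀ x xi y yi → (x * yi) * (y * xi) ≡ (xi * y) * (yi * x)
        lem′ = solve-∀

-- The modulus is a variable so that matching `refl` makes it a successor, the form in which `res`
-- unfolds to `_%_`.
theorem′ : (v x y a b c xi yi : ℕ) → v ≡ suc (a + b + c) → 1 < x → x < y →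
  StronglyAdmissible v (L3 a b c x y) →
  res v (x * xi) ≡ res v 1 →
  res v (y * yi) ≡ res v 1 →
  let dx = hat v (xi * y) ⊓ hat v xi
      dy = hat v (xi * y) ⊔ hat v xi
      ddx = hat v yi ⊓ hat v (x * yi)
      ddy = hat v yi ⊔ hat v (x * yi)
  in ((f x y ≤ a ⊎ f dx dy ≤ b ⊎ f ddx ddy ≤ c) → Realizable v (L3 a b c x y))
     × (¬ Realizable v (L3 a b c x y) → v + 2 ≤ f x y + f dx dy + f ddx ddy)
theorem′ v x y a b c xi yi refl 1<x x<y (_ , adm) ex ey = real , λ ¬real →
  -- Each bound that fails makes a value of `f` exceed its multiplicity, and
  -- `(a + 1) + (b + 1) + (c + 1) = v + 2`.
  ≤-trans (≤-reflexive (lem a b c)) (+-mono-≤ (+-mono-≤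
    (≰⇒> λ le → ¬real (real (inj₁ le)))
    (≰⇒> λ le → ¬real (real (inj₂ (inj₁ le)))))
    (≰⇒> λ le → ¬real (real (inj₂ (inj₂ le)))))
  where
  lem : ∀ a b c → suc (a + b + c) + 2 ≡ suc a + suc b + suc c
  lem = solve-∀
  empty : ∀ a b c → a + b + c ≡ 0 → Realizable (suc (a + b + c)) (L3 a b c x y)
  empty zero zero zero _ = 0 ∷ [] , ↭-refl , ↭-refl
  real : _ → Realizable (suc (a + b + c)) (L3 a b c x y)
  real hyp with 1 ≤? a + b + c
  ... | yes 1≤n = realizable x y a b c xi yi 1<x x<y adm ex ey 1≤n hyp
  -- For `v = 1` all hats are 0, outside the range of `core`; the one-vertex path serves.
  ... | no 1≰n = empty a b c (n<1⇒n≡0 (≰⇒> 1≰n))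

theorem3p6 : (x y a b c xi yi : ℕ) → 1 < x → x < y →
    StronglyAdmissible (a + b + c + 1) (L3 a b c x y) →
    res (a + b + c + 1) (x * xi) ≡ res (a + b + c + 1) 1 →
    res (a + b + c + 1) (y * yi) ≡ res (a + b + c + 1) 1 →
    let v = a + b + c + 1
        dx = hat v (xi * y) ⊓ hat v xi
        dy = hat v (xi * y) ⊔ hat v xi
        ddx = hat v yi ⊓ hat v (x * yi)
        ddy = hat v yi ⊔ hat v (x * yi)
    in ((f x y ≤ a ⊎ f dx dy ≤ b ⊎ f ddx ddy ≤ c) → Realizable v (L3 a b c x y))
       × (¬ Realizable v (L3 a b c x y) → v + 2 ≤ f x y + f dx dy + f ddx ddy)
theorem3p6 x y a b c xi yi = theorem′ (a + b + c + 1) x y a b c xi yi (+-comm (a + b + c) 1)
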